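{- Let $d=(d_1,\ldots,d_n)$ be a non-increasing sequence of positive integers such that $d_1\geq 2$ and $\sum_{i=1}^n d_i=2n-2c$ for some positive integer $c$. Then $$ \gamma_{\max}^{\mathcal F}(d)= \begin{cases} n-n_1(d)+c-1, & \text{if } n_1(d)>n_{\geq 2}(d) \text{ and } c-1<\left\lceil\frac{n_1(d)-n_{\geq 2}(d)}{2}\right\rceil,\\[2mm] \left\lfloor\frac{n}{2}\right\rfloor, & \text{if } n_1(d)>n_{\geq 2}(d) \text{ and } c-1\geq \left\lceil\frac{n_1(d)-n_{\geq 2}(d)}{2}\right\rceil,\\[2mm] \left\lceil\frac{n+n_1(d)-2}{3}\right\rceil, & \text{if } n_1(d)\leq n_{\geq 2}(d). \end{cases} $$
   Context: All graphs are finite, simple and undirected. For a sequence $d$ of non-negative integers, $\mathcal F(d)$ denotes the set of all forests whose degree sequence is $d$, and $\gamma_{\max}^{\mathcal F}(d)=\max\{\gamma(F):F\in\mathcal F(d)\}$, where $\gamma(F)$ is the domination number of $F$ (the minimum cardinality of a set $D$ of vertices such that every vertex not in $D$ has a neighbor in $D$). For an integer $i\ge 0$, $n_i(d)$ and $n_{\geq i}(d)$ denote the number of entries of $d$ equal to $i$ and at least $i$, respectively. (A sequence of positive integers with sum $2n-2c$, $c\ge1$, is the degree sequence of a forest, and every such forest has exactly $c$ components.) -}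

module Defs where

open import Data.Nat using (ℕ; zero; suc; _+_; _∸_; _≤_; _<_; _/_)
open import Data.Bool using (Bool; true; false; _∨_)
open import Data.Fin using (Fin; toℕ)
open import Data.Fin.Subset using (Subset; _∈_; ∣_∣)
open import Data.List using (List; []; _∷_; length; allFin; filter; last)
open import Data.List.Relation.Unary.Linked using (Linked)
open import Data.List.Relation.Unary.Unique.Propositional using (Unique)
open import Data.Product using (Σ; _×_; ∃; ∃-syntax)
open import Data.Maybe using (just)
open import Data.Empty using (⊥)
open import Relation.Nullary using (¬_)
open import Relation.Binary.PropositionalEquality using (_≡_)

record Graph (n : ℕ) : Set where
  field
    adj   : Fin n → Fin n → Bool
    sym   : ∀ i j → adj i j ≡ adj j i
    irrefl : ∀ i → adj i i ≡ false
open Graph public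

Adj : ∀ {n} → Graph n → Fin n → Fin n → Set
Adj G i j = adj G i j ≡ true

deg : ∀ {n} → Graph n → Fin n → ℕ
deg {n} G i = length (filter (λ j → Data.Bool._≟_ (adj G i j) true) (allFin n))
  where import Data.Bool

record Cycle {n : ℕ} (G : Graph n) : Set where
  field
    v₀      : Fin n
    rest    : List (Fin n)
    long    : 2 ≤ length rest
    distinct : Unique (v₀ ∷ rest)
    path    : Linked (Adj G) (v₀ ∷ rest)
    closing : ∀ w → last rest ≡ just w → Adj G w v₀

IsForest : ∀ {n} → Graph n → Set
IsForest G = ¬ Cycle G

HasDegSeq : ∀ {n} → Graph n → (Fin n → ℕ) → Set
HasDegSeq G d = ∀ i → deg G i ≡ d i

Dominating : ∀ {n} → Graph n → Subset n → Set
Dominating {n} G D = ∀ v → v ∈ D ⊎' (∃[ u ] (u ∈ D × Adj G v u))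
  where
  open import Data.Sum using () renaming (_⊎_ to _⊎'_)

IsDominationNumber : ∀ {n} → Graph n → ℕ → Set
IsDominationNumber G k =
  (∃[ D ] (Dominating G D × ∣ D ∣ ≡ k)) × (∀ D → Dominating G D → k ≤ ∣ D ∣)

IsGammaMaxForest : ∀ {n} → (Fin n → ℕ) → ℕ → Set
IsGammaMaxForest {n} d k =
  (∃[ F ] (IsForest F × HasDegSeq F d × IsDominationNumber F k)) ×
  (∀ (F : Graph n) (g : ℕ) → IsForest F → HasDegSeq F d → IsDominationNumber F g → g ≤ k)

seqSum : ∀ {n} → (Fin n → ℕ) → ℕ
seqSum {n} d = sum (Data.List.map d (allFin n))
  where import Data.List
        open import Data.Nat.ListAction using (sum)

count= : ∀ {n} → ℕ → (Fin n → ℕ) → ℕ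
count= {n} i d = length (filter (λ j → d j Data.Nat.≟ i) (allFin n))
  where import Data.Nat

count≥ : ∀ {n} → ℕ → (Fin n → ℕ) → ℕ
count≥ {n} i d = length (filter (λ j → i Data.Nat.≤? d j) (allFin n))
  where import Data.Nat

⌈_/_⌉ : ℕ → (k : ℕ) → .{{_ : Data.Nat.NonZero k}} → ℕ
⌈ m / k ⌉ = (m + (k ∸ 1)) / k
  where import Data.Nat

module Submission where

-- Upper bounds. A forest has an elimination order, each vertex having at most one
-- neighbour among the earlier ones, and can be coloured greedily along it. Two colours
-- give two disjoint dominating sets, hence γ ≤ n / 2; taking all internal vertices and
-- one colour class of the K₂ components, of which there are at most c − 1, gives
-- γ ≤ n − n₁ + c − 1. With three colours every internal vertex sees all of them in its
-- closed neighbourhood and a leaf misses one, so three dominating sets of total size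
-- n + n₁ exist.
--
-- Lower bounds. Every construction exhibits disjoint sets each containing a closed
-- neighbourhood. Process the vertices in the order: the largest internal vertex and a
-- leaf, the internal vertices that will not get a leaf of their own (all of degree 2),
-- then every other internal vertex (by decreasing degree) directly followed by a leaf,
-- then the surplus leaves. A new vertex is joined to the most recent one that still lacks
-- neighbours and starts a new component if there is none. The blocks are the pairs
-- (internal vertex, leaf), triples of consecutive unpaired vertices, and the K₂ components.

open import Defs
open import Data.Bool using (Bool; true; false; _∧_; _∨_; not)
import Data.Bool.Properties as 𝔹
open import Data.Nat using (ℕ; zero; suc; _+_; _*_; _∸_; _≤_; _<_; z≤n; s≤s; s≤s⁻¹; ⌊_/2⌋; ⌈_/2⌉; _≤?_)
import Data.Nat as ℕ
open import Data.Nat.Properties as ℕ hiding (_≟_)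
open import Data.Nat.DivMod using (_/_; m*n/n≡m; /-monoˡ-≤; m<n*o⇒m/o<n)
open import Data.Nat.ListAction using (sum)
open import Data.Nat.ListAction.Properties using (sum-↭)
open import Data.Nat.Tactic.RingSolver using (solve-∀)
open import Data.Fin using (Fin; zero; suc; _≟_) renaming (_≤_ to _≤ᶠ_)
open import Data.Fin.Properties using (injective⇒≤; all?)
open import Data.Fin.Subset using (Subset; ∣_∣) renaming (_∈_ to _∈ₛ_)
open import Data.List using (List; []; _∷_; _++_; map; length; filter; replicate; allFin; last; [_]; lookup)
import Data.List as List
import Data.List.Properties as ListP
open import Data.List.Properties using (map-tabulate)
open import Data.List.Membership.Propositional using (_∈_; _∉_; find)
import Data.List.Membership.DecPropositional as DecMembership
open import Data.List.Membership.Propositional.Properties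
open import Data.List.Relation.Binary.Permutation.Propositional using (_↭_; ↭-sym; ↭-trans; ↭-refl; prep; ↭⇒↭ₛ)
open import Data.List.Relation.Binary.Permutation.Propositional.Properties using (map⁺; ∈-resp-↭; shift; ↭-length)
import Data.List.Relation.Binary.Permutation.Setoid.Properties as ↭ₛ
open import Data.List.Relation.Unary.All as All using (All; []; _∷_)
import Data.List.Relation.Unary.All.Properties as AllP
open import Data.List.Relation.Unary.Any as Any using (here; there)
open import Data.List.Relation.Unary.AllPairs using (AllPairs; []; _∷_)
import Data.List.Relation.Unary.AllPairs.Properties as AllPairsP
open import Data.List.Relation.Unary.Linked using (Linked; []; [-]; _∷_)
open import Data.List.Relation.Unary.Unique.Propositional using (Unique)
open import Data.List.Relation.Unary.Unique.Propositional.Properties using (allFin⁺; filter⁺)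
open import Data.Maybe using (just)
open import Data.Maybe.Properties using (just-injective)
open import Data.Product using (Σ; _×_; ∃; ∃₂; _,_; proj₁; proj₂)
import Data.Sum as Sum
open import Data.Sum using (_⊎_; inj₁; inj₂; [_,_]′)
open import Data.Unit using (⊤)
open import Data.Empty using (⊥-elim)
open import Data.Vec using (tabulate; []; _∷_)
import Data.Vec as Vec
open import Data.Vec.Properties using ([]=⇒lookup; lookup⇒[]=; lookup∘tabulate)
open import Function using (_∘_; id)
open import Relation.Binary.PropositionalEquality as ≡ using (_≡_; _≢_; refl; cong; cong₂; subst; subst₂; trans; module ≡-Reasoning)
open import Relation.Nullary using (Dec; yes; no; does; ¬_; contradiction)
open import Relation.Nullary.Decidable using (dec-true; dec-false; ¬?; from-yes; _→-dec_; _⊎-dec_)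

variable
  A : Set
  n : ℕ

-- Finite sums

𝟙 : Bool → ℕ
𝟙 true  = 1
𝟙 false = 0

𝟙-∨ : ∀ a b → 𝟙 (a ∨ b) ≤ 𝟙 a + 𝟙 b
𝟙-∨ true  b = s≤s z≤n
𝟙-∨ false b = ≤-refl

𝟙-∧ : ∀ a b → 𝟙 (a ∧ b) ≡ 𝟙 a * 𝟙 b
𝟙-∧ true  b = ≡.sym (+-identityʳ (𝟙 b))
𝟙-∧ false b = refl

∑ : List A → (A → ℕ) → ℕ
∑ xs f = sum (map f xs)

∑-mono : ∀ {f g : A → ℕ} xs → (∀ {x} → x ∈ xs → f x ≤ g x) → ∑ xs f ≤ ∑ xs g
∑-mono []       f≤g = z≤n
∑-mono (x ∷ xs) f≤g = +-mono-≤ (f≤g (here refl)) (∑-mono xs (f≤g ∘ there))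

∑-cong : ∀ {f g : A → ℕ} xs → (∀ {x} → x ∈ xs → f x ≡ g x) → ∑ xs f ≡ ∑ xs g
∑-cong []       f≡g = refl
∑-cong (x ∷ xs) f≡g = cong₂ _+_ (f≡g (here refl)) (∑-cong xs (f≡g ∘ there))

∑-++ : ∀ (f : A → ℕ) xs ys → ∑ (xs ++ ys) f ≡ ∑ xs f + ∑ ys f
∑-++ f []       ys = refl
∑-++ f (x ∷ xs) ys = trans (cong (f x +_) (∑-++ f xs ys)) (≡.sym (+-assoc (f x) _ _))

∑-+ : ∀ (f g : A → ℕ) xs → ∑ xs (λ x → f x + g x) ≡ ∑ xs f + ∑ xs g
∑-+ f g []       = refl
∑-+ f g (x ∷ xs) = trans (cong (f x + g x +_) (∑-+ f g xs)) (interchange (f x) (g x) _ _)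
  where
  interchange : ∀ a b c e → a + b + (c + e) ≡ a + c + (b + e)
  interchange = solve-∀

∑-*ˡ : ∀ k (f : A → ℕ) xs → ∑ xs (λ x → k * f x) ≡ k * ∑ xs f
∑-*ˡ k f []       = ≡.sym (*-zeroʳ k)
∑-*ˡ k f (x ∷ xs) = trans (cong (k * f x +_) (∑-*ˡ k f xs)) (≡.sym (*-distribˡ-+ k (f x) _))

∑-const : ∀ k (xs : List A) → ∑ xs (λ _ → k) ≡ length xs * k
∑-const k []       = refl
∑-const k (x ∷ xs) = cong (k +_) (∑-const k xs)

∑-replicate : ∀ (f : A → ℕ) k x → ∑ (replicate k x) f ≡ k * f x
∑-replicate f zero    x = refl
∑-replicate f (suc k) x = cong (f x +_) (∑-replicate f k x)

∑-↭ : ∀ (f : A → ℕ) {xs ys} → xs ↭ ys → ∑ xs f ≡ ∑ ys f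
∑-↭ f p = sum-↭ (map⁺ f p)

∑-comm : ∀ {B : Set} (f : A → B → ℕ) xs ys → ∑ xs (λ x → ∑ ys (f x)) ≡ ∑ ys (λ y → ∑ xs (λ x → f x y))
∑-comm f []       ys = ≡.sym (trans (∑-const 0 ys) (*-zeroʳ (length ys)))
∑-comm f (x ∷ xs) ys = trans (cong (∑ ys (f x) +_) (∑-comm f xs ys)) (≡.sym (∑-+ (f x) _ ys))

∑-map : ∀ {B : Set} (g : A → B) (f : B → ℕ) xs → ∑ (map g xs) f ≡ ∑ xs (f ∘ g)
∑-map g f []       = refl
∑-map g f (x ∷ xs) = cong (f (g x) +_) (∑-map g f xs)

f≤∑ : ∀ (f : A → ℕ) {x xs} → x ∈ xs → f x ≤ ∑ xs f
f≤∑ f (here refl)             = m≤m+n _ _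
f≤∑ f (there {x = y} x∈xs) = ≤-trans (f≤∑ f x∈xs) (m≤n+m _ (f y))

f+f≤∑ : ∀ (f : A → ℕ) {x y xs} → x ≢ y → x ∈ xs → y ∈ xs → f x + f y ≤ ∑ xs f
f+f≤∑ f x≢y (here refl) (here refl) = contradiction refl x≢y
f+f≤∑ f x≢y (here refl) (there y∈)  = +-monoʳ-≤ (f _) (f≤∑ f y∈)
f+f≤∑ f {x} x≢y (there x∈) (here {x = y} refl) = ≤-trans (≤-reflexive (+-comm (f x) (f y))) (+-monoʳ-≤ (f y) (f≤∑ f x∈))
f+f≤∑ f x≢y (there {x = z} x∈) (there y∈) = ≤-trans (f+f≤∑ f x≢y x∈ y∈) (m≤n+m _ (f z))

module _ {P : A → Set} (P? : ∀ x → Dec (P x)) where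

  ∑-filter : ∀ (f : A → ℕ) xs → ∑ (filter P? xs) f ≡ ∑ xs (λ x → 𝟙 (does (P? x)) * f x)
  ∑-filter f []       = refl
  ∑-filter f (x ∷ xs) with does (P? x)
  ... | true  = cong₂ _+_ (≡.sym (+-identityʳ (f x))) (∑-filter f xs)
  ... | false = ∑-filter f xs

  length-filter≡∑ : ∀ xs → length (filter P? xs) ≡ ∑ xs (λ x → 𝟙 (does (P? x)))
  length-filter≡∑ []       = refl
  length-filter≡∑ (x ∷ xs) with does (P? x)
  ... | true  = cong suc (length-filter≡∑ xs)
  ... | false = length-filter≡∑ xs

-- Pigeonhole for choosing the smallest of several dominating sets, multiplied out to avoid
-- division.
minimum≤average : ∀ (f : A → ℕ) x xs → ∃ λ y → length (x ∷ xs) * f y ≤ ∑ (x ∷ xs) f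
minimum≤average f x []        = x , ≤-refl
minimum≤average f x (x′ ∷ xs) with minimum≤average f x′ xs
... | y , le with ≤-total (f x) (f y)
...   | inj₁ fx≤fy = x , +-monoʳ-≤ (f x) (≤-trans (*-monoʳ-≤ (length (x′ ∷ xs)) fx≤fy) le)
...   | inj₂ fy≤fx = y , +-mono-≤ fy≤fx le

∑-allFin-suc : ∀ (f : Fin (suc n) → ℕ) → ∑ (allFin (suc n)) f ≡ f zero + ∑ (allFin n) (f ∘ suc)
∑-allFin-suc {n} f = cong (λ xs → f zero + sum xs)
  (trans (map-tabulate suc f) (≡.sym (map-tabulate id (f ∘ suc))))

∑-δ : ∀ (i : Fin n) → ∑ (allFin n) (λ j → 𝟙 (does (i ≟ j))) ≡ 1
∑-δ {suc n} zero = trans (∑-allFin-suc {n} (λ j → 𝟙 (does (zero ≟ j))))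
  (cong suc (trans (∑-const 0 (allFin n)) (*-zeroʳ (length (allFin n)))))
∑-δ (suc i) = trans (∑-allFin-suc (λ j → 𝟙 (does (suc i ≟ j)))) (∑-δ i)

∣∣≡∑ : ∀ (D : Subset n) → ∣ D ∣ ≡ ∑ (allFin n) (λ i → 𝟙 (Vec.lookup D i))
∣∣≡∑ []          = refl
∣∣≡∑ (true  ∷ D) = trans (cong suc (∣∣≡∑ D)) (≡.sym (∑-allFin-suc (λ i → 𝟙 (Vec.lookup (true ∷ D) i))))
∣∣≡∑ (false ∷ D) = trans (∣∣≡∑ D) (≡.sym (∑-allFin-suc (λ i → 𝟙 (Vec.lookup (false ∷ D) i))))

length-allFin : ∀ n → length (allFin n) ≡ n
length-allFin n = ListP.length-tabulate id

-- Neighbours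

≡true∨≡false : ∀ b → (b ≡ true) ⊎ (b ≡ false)
≡true∨≡false true  = inj₁ refl
≡true∨≡false false = inj₂ refl

-- Lists stand for vertex sets. Unlike the filtered list in `deg`, a sum is invariant under
-- permutation and splits off one vertex at a time.
degIn : Graph n → List (Fin n) → Fin n → ℕ
degIn G xs v = ∑ xs (λ u → 𝟙 (adj G v u))

deg≡degIn : ∀ (G : Graph n) v → deg G v ≡ degIn G (allFin n) v
deg≡degIn {n} G v = trans (length-filter≡∑ _ (allFin n)) (∑-cong (allFin n) (λ {u} _ → cong 𝟙 (does-≟true (adj G v u))))
  where
  does-≟true : ∀ b → does (b 𝔹.≟ true) ≡ b
  does-≟true true  = refl
  does-≟true false = refl

module _ (G : Graph n) where

  Adj-sym : ∀ {v u} → Adj G v u → Adj G u v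
  Adj-sym {v} {u} = trans (Graph.sym G u v)

  Adj⇒≢ : ∀ {v u} → Adj G v u → v ≢ u
  Adj⇒≢ {v} vv refl with trans (≡.sym vv) (irrefl G v)
  ... | ()

  neighbour : ∀ {v} xs → 1 ≤ degIn G xs v → ∃ λ a → a ∈ xs × Adj G v a
  neighbour {v} (x ∷ xs) 1≤ with ≡true∨≡false (adj G v x)
  ... | inj₁ vx = x , here refl , vx
  ... | inj₂ eq rewrite eq with neighbour xs 1≤
  ...   | a , a∈ , va = a , there a∈ , va

  two-neighbours : ∀ {v xs} → Unique xs → 2 ≤ degIn G xs v →
    ∃₂ λ a b → a ≢ b × a ∈ xs × b ∈ xs × Adj G v a × Adj G v b
  two-neighbours {v} {x ∷ xs} (x∉ ∷ u) 2≤ with ≡true∨≡false (adj G v x)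
  ... | inj₂ eq rewrite eq with two-neighbours u 2≤
  ...   | a , b , a≢b , a∈ , b∈ , va , vb = a , b , a≢b , there a∈ , there b∈ , va , vb
  two-neighbours {v} {x ∷ xs} (x∉ ∷ u) 2≤ | inj₁ vx rewrite vx with neighbour xs (s≤s⁻¹ 2≤)
  ...   | b , b∈ , vb = x , b , All.lookup x∉ b∈ , here refl , there b∈ , vx , vb

  neighbour-unique : ∀ {v xs a b} → degIn G xs v ≤ 1 → a ∈ xs → b ∈ xs → Adj G v a → Adj G v b → a ≡ b
  neighbour-unique {v} {xs} {a} {b} ≤1 a∈ b∈ va vb with a ≟ b
  ... | yes a≡b = a≡b
  ... | no  a≢b with ≤-trans (2≤degIn (f+f≤∑ (λ u → 𝟙 (adj G v u)) a≢b a∈ b∈)) ≤1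
    where
    2≤degIn : 𝟙 (adj G v a) + 𝟙 (adj G v b) ≤ degIn G xs v → 2 ≤ degIn G xs v
    2≤degIn p rewrite va | vb = p
  ...   | s≤s ()

-- Elimination orders of a forest

-- The head comes last in the order, so its earlier neighbours are those in the tail.
data Elim (G : Graph n) : List (Fin n) → Set where
  []  : Elim G []
  add : ∀ {v vs} → v ∉ vs → degIn G vs v ≤ 1 → Elim G vs → Elim G (v ∷ vs)

-- Positions of a duplicate-free list inject into `Fin n`. This limits the length of the path in
-- `grow`, so that its fuel suffices.
unique-length : ∀ {xs : List (Fin n)} → Unique xs → length xs ≤ n
unique-length {xs = xs} u = injective⇒≤ {f = lookup xs} (lookup-injective u)
  where
  lookup-injective : ∀ {xs : List (Fin n)} → Unique xs → ∀ {i j} → lookup xs i ≡ lookup xs j → i ≡ j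
  lookup-injective (x∉ ∷ u) {zero}  {zero}  eq = refl
  lookup-injective (x∉ ∷ u) {zero}  {suc j} eq = ⊥-elim (All.lookup x∉ (∈-lookup j) eq)
  lookup-injective (x∉ ∷ u) {suc i} {zero}  eq = ⊥-elim (All.lookup x∉ (∈-lookup i) (≡.sym eq))
  lookup-injective (x∉ ∷ u) {suc i} {suc j} eq = cong suc (lookup-injective u eq)

Linked-++⁻ˡ : ∀ {R : A → A → Set} xs {ys} → Linked R (xs ++ ys) → Linked R xs
Linked-++⁻ˡ []           l       = []
Linked-++⁻ˡ (x ∷ [])     l       = [-]
Linked-++⁻ˡ (x ∷ y ∷ xs) (r ∷ l) = r ∷ Linked-++⁻ˡ (y ∷ xs) l

AllPairs-++⁻ˡ : ∀ {R : A → A → Set} xs {ys} → AllPairs R (xs ++ ys) → AllPairs R xs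
AllPairs-++⁻ˡ []       u       = []
AllPairs-++⁻ˡ (x ∷ xs) (p ∷ u) = AllP.++⁻ˡ xs p ∷ AllPairs-++⁻ˡ xs u

AllPairs-++⁻-cross : ∀ {R : A → A → Set} {xs ys x y} → AllPairs R (xs ++ ys) → x ∈ xs → y ∈ ys → R x y
AllPairs-++⁻-cross {xs = _ ∷ xs} (p ∷ u) (here refl) y∈ = All.lookup p (∈-++⁺ʳ xs y∈)
AllPairs-++⁻-cross (p ∷ u) (there x∈) y∈ = AllPairs-++⁻-cross u x∈ y∈

Unique-resp-↭ : ∀ {xs ys : List A} → xs ↭ ys → Unique xs → Unique ys
Unique-resp-↭ p = ↭ₛ.Unique-resp-↭ (≡.setoid _) (↭⇒↭ₛ p)

last-∷ʳ : ∀ (x y : A) xs → last (x ∷ xs ++ [ y ]) ≡ just y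
last-∷ʳ x y []        = refl
last-∷ʳ x y (x′ ∷ xs) = last-∷ʳ x′ y xs

++-assoc-∷ : ∀ (xs : List A) z zs → xs ++ z ∷ zs ≡ (xs ++ [ z ]) ++ zs
++-assoc-∷ xs z zs = ≡.sym (ListP.++-assoc xs [ z ] zs)

module _ (G : Graph n) where

  open DecMembership (_≟_ {n}) using (_∈?_)

  -- A path is prolonged at its head until the new vertex already lies on it.
  grow : ∀ {S} → Unique S → (∀ {v} → v ∈ S → 2 ≤ degIn G S v) →
    ∀ fuel {x y ps} → x ∈ S → Unique (x ∷ y ∷ ps) → Linked (Adj G) (x ∷ y ∷ ps) →
    n < fuel + length (x ∷ y ∷ ps) → Cycle G
  grow uS deg2 zero x∈ u l n< = contradiction (unique-length u) (<⇒≱ n<)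
  grow {S} uS deg2 (suc fuel) {x} {y} {ps} x∈ u l n< with other
    where
    other : ∃ λ z → z ≢ y × z ∈ S × Adj G x z
    other with two-neighbours G uS (deg2 x∈)
    ... | a , b , a≢b , a∈ , b∈ , xa , xb with a ≟ y
    ...   | no a≢y   = a , a≢y , a∈ , xa
    ...   | yes refl = b , ≡.≢-sym a≢b , b∈ , xb
  ... | z , z≢y , z∈ , xz with z ∈? ps
  ...   | no z∉ = grow uS deg2 fuel z∈
            ((≡.≢-sym (Adj⇒≢ G xz) ∷ z≢y ∷ AllP.¬Any⇒All¬ ps z∉) ∷ u) (Adj-sym G xz ∷ l)
            (≤-trans n< (≤-reflexive (≡.sym (+-suc fuel _))))
  -- Since `z` lies beyond `y`, the stretch of the path from `x` to `z` has at least three vertices,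
  -- and the edge `xz` closes it.
  ...   | yes z∈ps with ∈-∃++ z∈ps
  ...     | as , bs , refl = record
    { v₀       = x
    ; rest     = y ∷ as ++ [ z ]
    ; long     = s≤s (≤-trans (s≤s z≤n) (≤-trans (m≤n+m 1 (length as)) (≤-reflexive (≡.sym (ListP.length-++ as)))))
    ; distinct = AllPairs-++⁻ˡ (x ∷ y ∷ as ++ [ z ]) (subst (λ zs → Unique (x ∷ y ∷ zs)) (++-assoc-∷ as z bs) u)
    ; path     = Linked-++⁻ˡ (x ∷ y ∷ as ++ [ z ]) (subst (λ zs → Linked (Adj G) (x ∷ y ∷ zs)) (++-assoc-∷ as z bs) l)
    ; closing  = λ { w eq → subst (λ w → Adj G w x) (just-injective (trans (≡.sym (last-∷ʳ y z as)) eq)) (Adj-sym G xz) }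
    }

  min-degree-2⇒cycle : ∀ {S v} → Unique S → v ∈ S → (∀ {v} → v ∈ S → 2 ≤ degIn G S v) → Cycle G
  min-degree-2⇒cycle uS v∈ deg2 with two-neighbours G uS (deg2 v∈)
  -- Fuel plus path length starts at `n + 2` and never changes, so a path that used up all fuel
  -- would have more than `n` vertices.
  ... | a , _ , _ , a∈ , _ , va , _ =
    grow uS deg2 n a∈ ((≡.≢-sym (Adj⇒≢ G va) ∷ []) ∷ [] ∷ []) (Adj-sym G va ∷ [-])
      (m<m+n n (s≤s z≤n))

  -- Some vertex of a nonempty set has at most one neighbour in it, as otherwise there is a cycle.
  -- It is put last and the rest is ordered recursively; `k` makes the recursion structural.
  elimination : IsForest G → ∀ k S → length S ≡ k → Unique S → ∃ λ vs → vs ↭ S × Elim G vs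
  elimination forest zero    []      refl u = [] , ↭-refl , []
  elimination forest (suc k) (s ∷ S) eq   u with Any.any? (λ v → degIn G (s ∷ S) v ≤? 1) (s ∷ S)
  ... | no ¬any = ⊥-elim (forest (min-degree-2⇒cycle u (here refl)
            (λ v∈ → ≰⇒> (All.lookup (AllP.¬Any⇒All¬ (s ∷ S) ¬any) v∈))))
  ... | yes any with find any
  ...   | v , v∈ , ≤1 with ∈-∃++ v∈
  ...     | as , bs , S≡ = go (subst (_↭ v ∷ as ++ bs) (≡.sym S≡) (shift v as bs))
    where
    go : s ∷ S ↭ v ∷ as ++ bs → ∃ λ vs → vs ↭ s ∷ S × Elim G vs
    go p with Unique-resp-↭ p u
    ... | v∉ ∷ u′ with elimination forest k (as ++ bs)
                         (ℕ.suc-injective (trans (≡.sym (↭-length p)) eq)) u′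
    ...   | vs , vs↭ , e = v ∷ vs , ↭-trans (prep v vs↭) (↭-sym p)
                , add (λ v∈vs → All.lookup v∉ (∈-resp-↭ vs↭ v∈vs) refl)
                      -- The bound found for `v` in `s ∷ S` passes to the smaller set `vs` along the
                      -- two permutations.
                      (≤-trans (≤-reflexive (∑-↭ _ vs↭)) (≤-trans (m≤n+m _ (𝟙 (adj G v v)))
                        (≤-trans (≤-reflexive (≡.sym (∑-↭ _ p))) ≤1))) e

  -- Every vertex brings at most one edge and the first brings none, so there are fewer edges than
  -- vertices; the degree sum counts each edge twice.
  elim-degree-sum : ∀ {v vs} → Elim G (v ∷ vs) → ∑ (v ∷ vs) (degIn G (v ∷ vs)) + 2 ≤ 2 * length (v ∷ vs)
  elim-degree-sum {v} {vs} (add v∉ ≤1 e) = begin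
    ∑ (v ∷ vs) (degIn G (v ∷ vs)) + 2                ≡⟨ cong (_+ 2) sum-eq ⟩
    degIn G vs v + (degIn G vs v + ∑ vs (degIn G vs)) + 2 ≤⟨ bound e ≤1 ⟩
    2 * length (v ∷ vs)                              ∎
    where
    open ≤-Reasoning
    sum-eq : ∑ (v ∷ vs) (degIn G (v ∷ vs)) ≡ degIn G vs v + (degIn G vs v + ∑ vs (degIn G vs))
    sum-eq = cong₂ _+_ (cong (λ b → 𝟙 b + degIn G vs v) (irrefl G v))
      (trans (∑-+ (λ x → 𝟙 (adj G x v)) (degIn G vs) vs)
        (cong (_+ ∑ vs (degIn G vs)) (∑-cong vs (λ {x} _ → cong 𝟙 (Graph.sym G x v)))))
    bound : ∀ {vs} → Elim G vs → degIn G vs v ≤ 1 →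
      degIn G vs v + (degIn G vs v + ∑ vs (degIn G vs)) + 2 ≤ 2 * length (v ∷ vs)
    -- The first vertex has no earlier neighbour, which is where the `+ 2` comes from.
    bound {[]}      e′ ≤1 = ≤-refl
    bound {w ∷ ws} e′ ≤1 = begin
      δ + (δ + ∑ (w ∷ ws) (degIn G (w ∷ ws))) + 2 ≡⟨ shuffle δ _ ⟩
      2 * δ + (∑ (w ∷ ws) (degIn G (w ∷ ws)) + 2) ≤⟨ +-mono-≤ (*-monoʳ-≤ 2 ≤1) (elim-degree-sum e′) ⟩
      2 + 2 * length (w ∷ ws)                     ≡⟨ ≡.sym (*-distribˡ-+ 2 1 (length (w ∷ ws))) ⟩
      2 * length (v ∷ w ∷ ws)                     ∎
      where
      δ = degIn G (w ∷ ws) v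
      shuffle : ∀ a b → a + (a + b) + 2 ≡ 2 * a + (b + 2)
      shuffle = solve-∀

-- Colourings

module _ {C : Set} (Q : C → C → Set) (fresh : C → C → C)
         (fresh-≢ : ∀ a b → fresh a b ≢ a) (fresh-Q : ∀ a b → Q (fresh a b) b) where

  -- `Q` is always true for two colours and is `_≢_` for three. In the latter case `varied` makes a
  -- vertex with two neighbours see all three colours.
  record Coloured (G : Graph n) (vs : List (Fin n)) : Set where
    field
      colour : Fin n → C
      proper : ∀ {v u} → v ∈ vs → u ∈ vs → Adj G v u → colour v ≢ colour u
      varied : ∀ {v a b} → v ∈ vs → a ∈ vs → b ∈ vs → a ≢ b → Adj G v a → Adj G v b →
               ∃₂ λ x y → x ∈ vs × y ∈ vs × Adj G v x × Adj G v y × Q (colour x) (colour y)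

  -- A new vertex v with one neighbour u avoids the colour of u and that of
  -- one further neighbour w of u, if there is any.
  elim-colouring : ∀ {G : Graph n} {vs} → C → Elim G vs → Coloured G vs
  elim-colouring c₀ [] = record { colour = λ _ → c₀ ; proper = λ () ; varied = λ () }
  elim-colouring {n} {G} {v ∷ vs} c₀ (add v∉ ≤1 e) = result
    where
    open Coloured (elim-colouring c₀ e)

    recolour : C → Fin n → C
    recolour c x with x ≟ v
    ... | yes _ = c
    ... | no  _ = colour x

    at-v : ∀ c → recolour c v ≡ c
    at-v c with v ≟ v
    ... | yes _  = refl
    ... | no v≢v = contradiction refl v≢v

    off-v : ∀ c {x} → x ∈ vs → recolour c x ≡ colour x
    off-v c {x} x∈ with x ≟ v
    ... | yes refl = contradiction x∈ v∉
    ... | no  _    = refl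

    -- Only the neighbour of `v` can newly acquire two neighbours. Hence `cQ` concerns only a
    -- neighbour `u` that already has a neighbour `w`.
    module _ (c : C) (c≢ : ∀ {u} → u ∈ vs → Adj G v u → c ≢ colour u)
             (cQ : ∀ {u w} → u ∈ vs → Adj G v u → w ∈ vs → Adj G u w →
                   ∃ λ w′ → w′ ∈ vs × Adj G u w′ × Q c (colour w′)) where

      proper′ : ∀ {x y} → x ∈ v ∷ vs → y ∈ v ∷ vs → Adj G x y → recolour c x ≢ recolour c y
      proper′ (here refl) (here refl) xy = contradiction refl (Adj⇒≢ G xy)
      proper′ (here refl) (there y∈)  xy rewrite at-v c | off-v c y∈ = c≢ y∈ xy
      proper′ (there x∈)  (here refl) xy rewrite at-v c | off-v c x∈ = ≡.≢-sym (c≢ x∈ (Adj-sym G xy))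
      proper′ (there x∈)  (there y∈)  xy rewrite off-v c x∈ | off-v c y∈ = proper x∈ y∈ xy

      varied-at-neighbour : ∀ {x b} → x ∈ vs → b ∈ vs → Adj G x v → Adj G x b →
        ∃₂ λ y z → y ∈ v ∷ vs × z ∈ v ∷ vs × Adj G x y × Adj G x z × Q (recolour c y) (recolour c z)
      varied-at-neighbour x∈ b∈ xv xb with cQ x∈ (Adj-sym G xv) b∈ xb
      ... | w , w∈ , xw , q = v , w , here refl , there w∈ , xv , xw ,
              ≡.subst₂ Q (≡.sym (at-v c)) (≡.sym (off-v c w∈)) q

      varied′ : ∀ {x a b} → x ∈ v ∷ vs → a ∈ v ∷ vs → b ∈ v ∷ vs → a ≢ b → Adj G x a → Adj G x b →
        ∃₂ λ y z → y ∈ v ∷ vs × z ∈ v ∷ vs × Adj G x y × Adj G x z × Q (recolour c y) (recolour c z)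
      varied′ (here refl) (here refl) b∈          a≢b xa xb = contradiction refl (Adj⇒≢ G xa)
      varied′ (here refl) (there a∈)  (here refl) a≢b xa xb = contradiction refl (Adj⇒≢ G xb)
      varied′ (here refl) (there a∈)  (there b∈)  a≢b xa xb = contradiction (neighbour-unique G ≤1 a∈ b∈ xa xb) a≢b
      varied′ (there x∈)  (here refl) (here refl) a≢b xa xb = contradiction refl a≢b
      varied′ (there x∈)  (here refl) (there b∈)  a≢b xa xb = varied-at-neighbour x∈ b∈ xa xb
      varied′ (there x∈)  (there a∈)  (here refl) a≢b xa xb = varied-at-neighbour x∈ a∈ xb xa
      varied′ (there x∈)  (there a∈)  (there b∈)  a≢b xa xb with varied x∈ a∈ b∈ a≢b xa xb
      ... | y , z , y∈ , z∈ , xy , xz , q = y , z , there y∈ , there z∈ , xy , xz ,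
              ≡.subst₂ Q (≡.sym (off-v c y∈)) (≡.sym (off-v c z∈)) q

      extended : Coloured G (v ∷ vs)
      extended = record { colour = recolour c ; proper = proper′ ; varied = varied′ }

    only : ∀ {u x} → u ∈ vs → Adj G v u → x ∈ vs → Adj G v x → u ≡ x
    only u∈ vu x∈ vx = neighbour-unique G ≤1 u∈ x∈ vu vx

    result : Coloured G (v ∷ vs)
    result with Any.any? (λ u → adj G v u 𝔹.≟ true) vs
    ... | no ¬vu = extended c₀
            (λ u∈ vu → contradiction vu (All.lookup (AllP.¬Any⇒All¬ vs ¬vu) u∈))
            (λ u∈ vu → contradiction vu (All.lookup (AllP.¬Any⇒All¬ vs ¬vu) u∈))
    ... | yes any with find any
    ...   | u , u∈ , vu with Any.any? (λ w → adj G u w 𝔹.≟ true) vs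
    -- Here `u` has no further neighbour, and the second argument of `fresh` is a dummy.
    ...     | no ¬uw = extended (fresh (colour u) (colour u))
                (λ x∈ vx → subst (λ x → fresh (colour u) (colour u) ≢ colour x) (only u∈ vu x∈ vx) (fresh-≢ _ _))
                (λ x∈ vx w∈ xw → contradiction
                  (subst (λ x → Adj G x _) (only x∈ vx u∈ vu) xw) (All.lookup (AllP.¬Any⇒All¬ vs ¬uw) w∈))
    ...     | yes any′ with find any′
    ...       | w , w∈ , uw = extended (fresh (colour u) (colour w))
                (λ x∈ vx → subst (λ x → fresh (colour u) (colour w) ≢ colour x) (only u∈ vu x∈ vx) (fresh-≢ _ _))
                (λ x∈ vx _ _ → w , w∈ , subst (λ x → Adj G x w) (only u∈ vu x∈ vx) uw , fresh-Q _ _)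

-- Small dominating sets from colour classes

dominating-tabulate : ∀ (G : Graph n) (S : Fin n → Bool) →
  (∀ v → S v ≡ true ⊎ ∃ λ u → S u ≡ true × Adj G v u) → Dominating G (tabulate S)
dominating-tabulate G S dom v with dom v
... | inj₁ Sv            = inj₁ (lookup⇒[]= v _ (trans (lookup∘tabulate S v) Sv))
... | inj₂ (u , Su , vu) = inj₂ (u , lookup⇒[]= u _ (trans (lookup∘tabulate S u) Su) , vu)

-- Double counting: the sizes of the `suc k` sets, summed vertex by vertex, total at most the sum of
-- `w`, and the smallest set is at most the average.
average-dominating : ∀ {k} (G : Graph n) (S : Fin (suc k) → Fin n → Bool) (w : Fin n → ℕ) →
  (∀ c v → S c v ≡ true ⊎ ∃ λ u → S c u ≡ true × Adj G v u) →
  (∀ v → ∑ (allFin (suc k)) (λ c → 𝟙 (S c v)) ≤ w v) →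
  ∃ λ D → Dominating G D × suc k * ∣ D ∣ ≤ ∑ (allFin n) w
average-dominating {n} {k} G S w dom S≤w with minimum≤average (λ c → ∣ tabulate (S c) ∣) zero (List.tabulate {n = k} suc)
... | c , le = tabulate (S c) , dominating-tabulate G (S c) (dom c) , (begin
    suc k * ∣ tabulate (S c) ∣                                          ≡⟨ cong (_* ∣ tabulate (S c) ∣) (≡.sym (length-allFin (suc k))) ⟩
    length (allFin (suc k)) * ∣ tabulate (S c) ∣                        ≤⟨ le ⟩
    ∑ (allFin (suc k)) (λ c → ∣ tabulate (S c) ∣)                       ≡⟨ ∑-cong (allFin (suc k)) (λ {c} _ → size c) ⟩
    ∑ (allFin (suc k)) (λ c → ∑ (allFin n) (λ v → 𝟙 (S c v)))           ≡⟨ ∑-comm (λ c v → 𝟙 (S c v)) (allFin (suc k)) (allFin n) ⟩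
    ∑ (allFin n) (λ v → ∑ (allFin (suc k)) (λ c → 𝟙 (S c v)))           ≤⟨ ∑-mono (allFin n) (λ {v} _ → S≤w v) ⟩
    ∑ (allFin n) w                                                      ∎)
  where
  open ≤-Reasoning
  size : ∀ c → ∣ tabulate (S c) ∣ ≡ ∑ (allFin n) (λ v → 𝟙 (S c v))
  size c = trans (∣∣≡∑ (tabulate (S c))) (∑-cong (allFin n) (λ {v} _ → cong 𝟙 (lookup∘tabulate (S c) v)))

other₂ : Fin 2 → Fin 2
other₂ zero       = suc zero
other₂ (suc zero) = zero

other₂-≢ : ∀ x → other₂ x ≢ x
other₂-≢ zero       ()
other₂-≢ (suc zero) ()

-- On equal arguments the value is just some other colour; the greedy colouring needs this for a
-- neighbour without further neighbours.
third : Fin 3 → Fin 3 → Fin 3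
third zero             (suc zero)       = suc (suc zero)
third zero             _                = suc zero
third (suc zero)       zero             = suc (suc zero)
third (suc zero)       _                = zero
third (suc (suc zero)) zero             = suc zero
third (suc (suc zero)) _                = zero

abstract

  -- This and the next three facts are finite and decided by evaluation; `abstract` keeps the
  -- evaluation from being unfolded later.
  two-colours : ∀ (x y c : Fin 2) → x ≢ y → c ≡ x ⊎ c ≡ y
  two-colours = from-yes (all? {n = 2} λ x → all? {n = 2} λ y → all? {n = 2} λ c →
    ¬? (x ≟ y) →-dec ((c ≟ x) ⊎-dec (c ≟ y)))

  third-≢ˡ : ∀ x y → third x y ≢ x
  third-≢ˡ = from-yes (all? λ x → all? λ y → ¬? (third x y ≟ x))

  third-≢ʳ : ∀ x y → third x y ≢ y
  third-≢ʳ = from-yes (all? λ x → all? λ y → ¬? (third x y ≟ y))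

  three-colours : ∀ (x y z c : Fin 3) → x ≢ y → x ≢ z → y ≢ z → c ≡ x ⊎ c ≡ y ⊎ c ≡ z
  three-colours = from-yes (all? {n = 3} λ x → all? {n = 3} λ y → all? {n = 3} λ z → all? {n = 3} λ c →
    ¬? (x ≟ y) →-dec (¬? (x ≟ z) →-dec (¬? (y ≟ z) →-dec ((c ≟ x) ⊎-dec ((c ≟ y) ⊎-dec (c ≟ z))))))

-- Putting a vertex into the one extra class `i` when `q` holds raises the number of its classes by
-- at most one.
class-sum-≤ : ∀ {k} (p : Fin k → Bool) q (i : Fin k) →
  ∑ (allFin k) (λ c → 𝟙 (p c ∨ (q ∧ does (i ≟ c)))) ≤ ∑ (allFin k) (λ c → 𝟙 (p c)) + 𝟙 q
class-sum-≤ {k} p q i = begin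
  ∑ (allFin k) (λ c → 𝟙 (p c ∨ (q ∧ does (i ≟ c))))
    ≤⟨ ∑-mono (allFin k) (λ {c} _ → ≤-trans (𝟙-∨ (p c) _) (≤-reflexive (cong (𝟙 (p c) +_) (𝟙-∧ q _)))) ⟩
  ∑ (allFin k) (λ c → 𝟙 (p c) + 𝟙 q * 𝟙 (does (i ≟ c)))
    ≡⟨ ∑-+ (λ c → 𝟙 (p c)) (λ c → 𝟙 q * 𝟙 (does (i ≟ c))) (allFin k) ⟩
  ∑ (allFin k) (λ c → 𝟙 (p c)) + ∑ (allFin k) (λ c → 𝟙 q * 𝟙 (does (i ≟ c)))
    ≡⟨ cong (∑ (allFin k) (λ c → 𝟙 (p c)) +_) (trans (∑-*ˡ (𝟙 q) (λ c → 𝟙 (does (i ≟ c))) (allFin k))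
         (trans (cong (𝟙 q *_) (∑-δ i)) (*-identityʳ _))) ⟩
  ∑ (allFin k) (λ c → 𝟙 (p c)) + 𝟙 q ∎
  where open ≤-Reasoning

∧-true : ∀ a {b} → a ∧ b ≡ true → a ≡ true × b ≡ true
∧-true true b≡true = refl , b≡true

does-true : ∀ {P : Set} (P? : Dec P) → does P? ≡ true → P
does-true (yes p) _ = p

≢1⇒2≤ : ∀ {k} → 1 ≤ k → k ≢ 1 → 2 ≤ k
≢1⇒2≤ 1≤k k≢1 = ≤∧≢⇒< 1≤k (≡.≢-sym k≢1)

-- The three upper bounds on the domination number

module UpperBounds (G : Graph n) (forest : IsForest G) (d : Fin n → ℕ)
                   (1≤d : ∀ v → 1 ≤ d v) (degs : HasDegSeq G d) where

  private
    V : List (Fin n)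
    V = allFin n

  degIn-V : ∀ v → degIn G V v ≡ d v
  degIn-V v = trans (≡.sym (deg≡degIn G v)) (degs v)

  neighbour-of : ∀ v → ∃ λ u → u ∈ V × Adj G v u
  neighbour-of v = neighbour G V (≤-trans (1≤d v) (≤-reflexive (≡.sym (degIn-V v))))

  nb : Fin n → Fin n
  nb v = proj₁ (neighbour-of v)

  Adj-nb : ∀ v → Adj G v (nb v)
  Adj-nb v = proj₂ (proj₂ (neighbour-of v))

  leaf-nb : ∀ {v u} → d v ≡ 1 → Adj G v u → nb v ≡ u
  leaf-nb {v} {u} dv vu = neighbour-unique G (≤-reflexive (trans (degIn-V v) dv))
    (∈-allFin (nb v)) (∈-allFin u) (Adj-nb v) vu

  module _ {C : Set} (Q : C → C → Set) (fresh : C → C → C)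
           (fresh-≢ : ∀ a b → fresh a b ≢ a) (fresh-Q : ∀ a b → Q (fresh a b) b) where

    colouring : C → ∃ λ (f : Fin n → C) →
      (∀ {v u} → Adj G v u → f v ≢ f u) ×
      (∀ {v} → 2 ≤ d v → ∃₂ λ x y → Adj G v x × Adj G v y × Q (f x) (f y))
    colouring c₀ with elimination G forest n V (length-allFin n) (allFin⁺ n)
    ... | vs , vs↭ , e = colour , proper (∈vs _) (∈vs _) , varied′
      where
      open Coloured (elim-colouring Q fresh fresh-≢ fresh-Q c₀ e)
      ∈vs : ∀ v → v ∈ vs
      ∈vs v = ∈-resp-↭ (↭-sym vs↭) (∈-allFin v)
      varied′ : ∀ {v} → 2 ≤ d v → ∃₂ λ x y → Adj G v x × Adj G v y × Q (colour x) (colour y)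
      varied′ {v} 2≤d with two-neighbours G (allFin⁺ n) (≤-trans 2≤d (≤-reflexive (≡.sym (degIn-V v))))
      ... | a , b , a≢b , _ , _ , va , vb with varied (∈vs v) (∈vs a) (∈vs b) a≢b va vb
      ...   | x , y , _ , _ , vx , vy , q = x , y , vx , vy , q

  bipartition : ∃ λ (f : Fin n → Fin 2) → ∀ {v u} → Adj G v u → f v ≢ f u
  bipartition with colouring (λ _ _ → ⊤) (λ a _ → other₂ a) (λ a _ → other₂-≢ a) _ zero
  ... | f , proper , _ = f , proper

  does-refl : ∀ {k} {x y : Fin k} → y ≡ x → does (x ≟ y) ≡ true
  does-refl {x = x} refl = dec-true (x ≟ x) refl

  -- There are no isolated vertices, so every vertex has a neighbour of the other colour and both
  -- colour classes dominate.
  half-bound : ∃ λ D → Dominating G D × 2 * ∣ D ∣ ≤ n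
  half-bound with bipartition
  ... | f , proper with average-dominating G (λ c v → does (f v ≟ c)) (λ _ → 1)
                          dom (λ v → ≤-reflexive (∑-δ (f v)))
    where
    dom : ∀ c v → does (f v ≟ c) ≡ true ⊎ ∃ λ u → does (f u ≟ c) ≡ true × Adj G v u
    dom c v with two-colours (f v) (f (nb v)) c (proper (Adj-nb v))
    ... | inj₁ c≡ = inj₁ (does-refl c≡)
    ... | inj₂ c≡ = inj₂ (nb v , does-refl c≡ , Adj-nb v)
  ...   | D , dom , le = D , dom , ≤-trans le (≤-reflexive (trans (∑-const 1 V) (trans (*-identityʳ _) (length-allFin n))))

  -- Every vertex of degree at least 2 sees all three colours; a leaf sees only two
  -- and is added to the class of the third.
  third-bound : ∃ λ D → Dominating G D × 3 * ∣ D ∣ ≤ n + count= 1 d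
  third-bound with colouring _≢_ third third-≢ˡ third-≢ʳ zero
  ... | f , proper , varied with average-dominating G S (λ v → 1 + 𝟙 (does (d v ℕ.≟ 1))) dom S≤
    where
    missing : Fin n → Fin 3
    missing v = third (f v) (f (nb v))
    S : Fin 3 → Fin n → Bool
    S c v = does (f v ≟ c) ∨ (does (d v ℕ.≟ 1) ∧ does (missing v ≟ c))
    S-colour : ∀ {c v} → c ≡ f v → S c v ≡ true
    S-colour c≡ rewrite does-refl c≡ = refl
    S-missing : ∀ {c v} → d v ≡ 1 → c ≡ missing v → S c v ≡ true
    S-missing {c} {v} dv c≡ rewrite dec-true (d v ℕ.≟ 1) dv | does-refl c≡ = 𝔹.∨-zeroʳ (does (f v ≟ c))
    dom : ∀ c v → S c v ≡ true ⊎ ∃ λ u → S c u ≡ true × Adj G v u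
    dom c v with d v ℕ.≟ 1
    ... | yes dv with three-colours (f v) (f (nb v)) (missing v) c (proper (Adj-nb v))
                        (≡.≢-sym (third-≢ˡ _ _)) (≡.≢-sym (third-≢ʳ _ _))
    ...   | inj₁ c≡        = inj₁ (S-colour c≡)
    ...   | inj₂ (inj₁ c≡) = inj₂ (nb v , S-colour c≡ , Adj-nb v)
    ...   | inj₂ (inj₂ c≡) = inj₁ (S-missing dv c≡)
    dom c v | no dv≢1 with varied (≢1⇒2≤ (1≤d v) dv≢1)
    ... | x , y , vx , vy , x≢y with three-colours (f v) (f x) (f y) c (proper vx) (proper vy) x≢y
    ...   | inj₁ c≡        = inj₁ (S-colour c≡)
    ...   | inj₂ (inj₁ c≡) = inj₂ (x , S-colour c≡ , vx)
    ...   | inj₂ (inj₂ c≡) = inj₂ (y , S-colour c≡ , vy)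
    open ≤-Reasoning
    S≤ : ∀ v → ∑ (allFin 3) (λ c → 𝟙 (S c v)) ≤ 1 + 𝟙 (does (d v ℕ.≟ 1))
    S≤ v = begin
      ∑ (allFin 3) (λ c → 𝟙 (S c v))
        ≤⟨ class-sum-≤ (λ c → does (f v ≟ c)) (does (d v ℕ.≟ 1)) (missing v) ⟩
      ∑ (allFin 3) (λ c → 𝟙 (does (f v ≟ c))) + 𝟙 (does (d v ℕ.≟ 1))
        ≡⟨ cong (_+ 𝟙 (does (d v ℕ.≟ 1))) (∑-δ (f v)) ⟩
      1 + 𝟙 (does (d v ℕ.≟ 1)) ∎
  ...   | D , dom , le = D , dom , ≤-trans le (≤-reflexive (trans (∑-+ (λ _ → 1) _ V)
            (cong₂ _+_ (trans (∑-const 1 V) (trans (*-identityʳ _) (length-allFin n)))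
                       (≡.sym (length-filter≡∑ _ V)))))

  private
    -- A leaf hanging from a leaf, that is, a vertex of a component with just one edge.
    K₂ : Fin n → Bool
    K₂ v = does (d v ℕ.≟ 1) ∧ does (d (nb v) ℕ.≟ 1)

    K₂⁺ : ∀ {v} → d v ≡ 1 → d (nb v) ≡ 1 → K₂ v ≡ true
    K₂⁺ {v} dv dnb rewrite dec-true (d v ℕ.≟ 1) dv = dec-true (d (nb v) ℕ.≟ 1) dnb

    K₂⁻ : ∀ {v} → K₂ v ≡ true → d v ≡ 1 × d (nb v) ≡ 1
    K₂⁻ {v} eq with ∧-true (does (d v ℕ.≟ 1)) eq
    ... | dv , dnb = does-true (d v ℕ.≟ 1) dv , does-true (d (nb v) ℕ.≟ 1) dnb

    -- No edge joins these components to the other vertices, so deleting them changes no degree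
    -- elsewhere.
    K₂-nb : ∀ {v u} → K₂ u ≡ true → Adj G v u → K₂ v ≡ true
    K₂-nb {v} {u} Ku vu with K₂⁻ Ku
    ... | du , dnb = K₂⁺ dv (trans (cong d (leaf-nb dv vu)) du)
      where
      dv : d v ≡ 1
      dv = trans (cong d (≡.sym (leaf-nb du (Adj-sym G vu)))) dnb

  -- The vertices outside the K₂ components induce a nonempty forest.
  K₂-vertices : ∀ c v₀ → 2 ≤ d v₀ → seqSum d + 2 * c ≡ 2 * n → ∑ V (λ v → 𝟙 (K₂ v)) + 2 ≤ 2 * c
  K₂-vertices c v₀ 2≤d sum-eq = nonempty (elimination G forest (length S) S refl unique)
    where
    open ≤-Reasoning
    S : List (Fin n)
    S = filter (λ v → K₂ v 𝔹.≟ false) V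
    τ = ∑ V (λ v → 𝟙 (K₂ v))
    unique : Unique S
    unique = filter⁺ (λ v → K₂ v 𝔹.≟ false) (allFin⁺ n)
    v₀∈S : v₀ ∈ S
    v₀∈S with ≡true∨≡false (K₂ v₀)
    ... | inj₂ K₂v₀ = ∈-filter⁺ _ (∈-allFin v₀) K₂v₀
    ... | inj₁ K₂v₀ = contradiction (proj₁ (K₂⁻ K₂v₀)) (≡.≢-sym (<⇒≢ 2≤d))
    degIn-S : ∀ {v} → v ∈ S → degIn G S v ≡ d v
    degIn-S {v} v∈ = trans (∑-filter _ _ V) (trans (∑-cong V (λ {u} _ → term u)) (degIn-V v))
      where
      term : ∀ u → 𝟙 (does (K₂ u 𝔹.≟ false)) * 𝟙 (adj G v u) ≡ 𝟙 (adj G v u)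
      term u with ≡true∨≡false (K₂ u) | ≡true∨≡false (adj G v u)
      ... | inj₂ K₂u | _       rewrite K₂u = *-identityˡ (𝟙 (adj G v u))
      ... | inj₁ _   | inj₂ vu rewrite vu  = *-zeroʳ (𝟙 (does (K₂ u 𝔹.≟ false)))
      ... | inj₁ K₂u | inj₁ vu with trans (≡.sym (K₂-nb K₂u vu)) (proj₂ (∈-filter⁻ _ {xs = V} v∈))
      ...   | ()
    sum-split : seqSum d ≡ ∑ S d + τ
    sum-split = trans (∑-cong V (λ {v} _ → split v)) (trans (∑-+ _ _ V) (cong (_+ τ) (≡.sym (∑-filter _ d V))))
      where
      split : ∀ v → d v ≡ 𝟙 (does (K₂ v 𝔹.≟ false)) * d v + 𝟙 (K₂ v)
      split v with ≡true∨≡false (K₂ v)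
      ... | inj₂ K₂v rewrite K₂v = ≡.sym (trans (+-identityʳ _) (*-identityˡ (d v)))
      ... | inj₁ K₂v rewrite K₂v = proj₁ (K₂⁻ K₂v)
    size-split : n ≡ length S + τ
    size-split = trans (≡.sym (length-allFin n)) (trans (≡.sym (*-identityʳ _)) (trans (≡.sym (∑-const 1 V))
      (trans (∑-cong V (λ {v} _ → split v)) (trans (∑-+ _ _ V) (cong (_+ τ) (≡.sym (length-filter≡∑ _ V)))))))
      where
      split : ∀ v → 1 ≡ 𝟙 (does (K₂ v 𝔹.≟ false)) + 𝟙 (K₂ v)
      split v with K₂ v
      ... | true  = refl
      ... | false = refl
    nonempty : (∃ λ vs → vs ↭ S × Elim G vs) → τ + 2 ≤ 2 * c
    nonempty ([] , vs↭ , _) with ∈-resp-↭ (↭-sym vs↭) v₀∈S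
    ... | ()
    -- Outside the K₂ components there are `n - τ` vertices with degree sum `2 n - 2 c - τ`. A
    -- forest on them has at most `n - τ - 1` edges, whence `τ + 2 ≤ 2 c`.
    nonempty (v ∷ vs , vs↭ , e) = +-cancelˡ-≤ (∑ S d + τ) _ _ (begin
      ∑ S d + τ + (τ + 2)        ≡⟨ shuffle₁ (∑ S d) τ ⟩
      (∑ S d + 2) + 2 * τ        ≤⟨ +-monoˡ-≤ (2 * τ) edges ⟩
      2 * length S + 2 * τ       ≡⟨ ≡.sym (*-distribˡ-+ 2 (length S) τ) ⟩
      2 * (length S + τ)         ≡⟨ cong (2 *_) (≡.sym size-split) ⟩
      2 * n                      ≡⟨ ≡.sym sum-eq ⟩
      seqSum d + 2 * c           ≡⟨ cong (_+ 2 * c) sum-split ⟩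
      ∑ S d + τ + 2 * c          ∎)
      where
      shuffle₁ : ∀ a t → a + t + (t + 2) ≡ a + 2 + 2 * t
      shuffle₁ = solve-∀
      edges : ∑ S d + 2 ≤ 2 * length S
      edges = begin
        ∑ S d + 2                               ≡⟨ cong (_+ 2) (∑-↭ d (↭-sym vs↭)) ⟩
        ∑ (v ∷ vs) d + 2                        ≡⟨ cong (_+ 2) (∑-cong (v ∷ vs) (λ x∈ → ≡.sym (trans (∑-↭ _ vs↭) (degIn-S (∈-resp-↭ vs↭ x∈))))) ⟩
        ∑ (v ∷ vs) (degIn G (v ∷ vs)) + 2       ≤⟨ elim-degree-sum G e ⟩
        2 * length (v ∷ vs)                     ≡⟨ cong (2 *_) (↭-length vs↭) ⟩
        2 * length S                            ∎

  -- A leaf outside the K₂ components has an internal neighbour. Internal vertices count in both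
  -- sets and K₂ vertices in one, and `K₂-vertices` bounds the number of the latter.
  internal-bound : ∀ c v₀ → 2 ≤ d v₀ → seqSum d + 2 * c ≡ 2 * n →
    ∃ λ D → Dominating G D × 2 * ∣ D ∣ + 2 ≤ 2 * (count≥ 2 d + c)
  internal-bound c v₀ 2≤d sum-eq with bipartition
  ... | f , proper with average-dominating G S (λ v → 2 * 𝟙 (does (2 ≤? d v)) + 𝟙 (K₂ v)) dom S≤
    where
    S : Fin 2 → Fin n → Bool
    S c v = does (2 ≤? d v) ∨ (K₂ v ∧ does (f v ≟ c))
    S-internal : ∀ {c v} → 2 ≤ d v → S c v ≡ true
    S-internal {v = v} 2≤ rewrite dec-true (2 ≤? d v) 2≤ = refl
    S-K₂ : ∀ {c v} → K₂ v ≡ true → c ≡ f v → S c v ≡ true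
    S-K₂ {v = v} Kv c≡ rewrite Kv | does-refl c≡ = 𝔹.∨-zeroʳ (does (2 ≤? d v))
    dom : ∀ c v → S c v ≡ true ⊎ ∃ λ u → S c u ≡ true × Adj G v u
    dom c v with d v ℕ.≟ 1
    ... | no dv≢1 = inj₁ (S-internal (≢1⇒2≤ (1≤d v) dv≢1))
    ... | yes dv with d (nb v) ℕ.≟ 1
    ...   | no dnb≢1 = inj₂ (nb v , S-internal (≢1⇒2≤ (1≤d _) dnb≢1) , Adj-nb v)
    ...   | yes dnb with two-colours (f v) (f (nb v)) c (proper (Adj-nb v))
    ...     | inj₁ c≡ = inj₁ (S-K₂ (K₂⁺ dv dnb) c≡)
    ...     | inj₂ c≡ = inj₂ (nb v , S-K₂ (K₂-nb (K₂⁺ dv dnb) (Adj-sym G (Adj-nb v))) c≡ , Adj-nb v)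
    open ≤-Reasoning
    S≤ : ∀ v → ∑ (allFin 2) (λ c → 𝟙 (S c v)) ≤ 2 * 𝟙 (does (2 ≤? d v)) + 𝟙 (K₂ v)
    S≤ v = begin
      ∑ (allFin 2) (λ c → 𝟙 (S c v))
        ≤⟨ class-sum-≤ (λ _ → does (2 ≤? d v)) (K₂ v) (f v) ⟩
      ∑ (allFin 2) (λ _ → 𝟙 (does (2 ≤? d v))) + 𝟙 (K₂ v)
        ≡⟨ cong (_+ 𝟙 (K₂ v)) (∑-const (𝟙 (does (2 ≤? d v))) (allFin 2)) ⟩
      2 * 𝟙 (does (2 ≤? d v)) + 𝟙 (K₂ v) ∎
  ...   | D , dom , le = D , dom , (begin
      2 * ∣ D ∣ + 2                                                    ≤⟨ +-monoˡ-≤ 2 le ⟩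
      ∑ V (λ v → 2 * 𝟙 (does (2 ≤? d v)) + 𝟙 (K₂ v)) + 2               ≡⟨ cong (_+ 2) (trans (∑-+ _ _ V) (cong (_+ ∑ V (λ v → 𝟙 (K₂ v)))
                                                                            (trans (∑-*ˡ 2 _ V) (cong (2 *_) (≡.sym (length-filter≡∑ _ V)))))) ⟩
      2 * count≥ 2 d + ∑ V (λ v → 𝟙 (K₂ v)) + 2                        ≡⟨ +-assoc (2 * count≥ 2 d) _ 2 ⟩
      2 * count≥ 2 d + (∑ V (λ v → 𝟙 (K₂ v)) + 2)                      ≤⟨ +-monoʳ-≤ (2 * count≥ 2 d) (K₂-vertices c v₀ 2≤d sum-eq) ⟩
      2 * count≥ 2 d + 2 * c                                           ≡⟨ ≡.sym (*-distribˡ-+ 2 (count≥ 2 d) c) ⟩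
      2 * (count≥ 2 d + c)                                             ∎)
      where open ≤-Reasoning

-- Hanging a new vertex on a forest

Isolated : Graph n → Fin n → Set
Isolated G v = ∀ x → adj G v x ≡ false

¬Adj-isolated : ∀ {G : Graph n} {v x} → Isolated G v → ¬ Adj G v x
¬Adj-isolated {x = x} iso vx with trans (≡.sym vx) (iso x)
... | ()

Linked-map-∈ : ∀ {R S : A → A → Set} {xs} → (∀ {x y} → x ∈ xs → y ∈ xs → R x y → S x y) → Linked R xs → Linked S xs
Linked-map-∈ f []      = []
Linked-map-∈ f [-]     = [-]
Linked-map-∈ f (r ∷ l) = f (here refl) (there (here refl)) r ∷ Linked-map-∈ (λ x∈ y∈ → f (there x∈) (there y∈)) l

last-∈ : ∀ (xs : List A) {w} → last xs ≡ just w → w ∈ xs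
last-∈ (x ∷ [])     refl = here refl
last-∈ (x ∷ y ∷ xs) eq   = there (last-∈ (y ∷ xs) eq)

last-∃ : ∀ (x : A) xs → ∃ λ w → last (x ∷ xs) ≡ just w
last-∃ x []       = x , refl
last-∃ x (y ∷ xs) = last-∃ y xs

module _ {G : Graph n} {v : Fin n} (leaf : ∀ {a b} → Adj G v a → Adj G v b → a ≡ b) where

  -- An inner vertex of a path has two distinct neighbours, so `v` can only be the end, and `a` is
  -- its predecessor. The case `xs ≡ [ v ]` is kept apart because the predecessor is then `p`.
  leaf-on-path : ∀ p xs → v ∈ xs → Unique (p ∷ xs) → Linked (Adj G) (p ∷ xs) →
    last xs ≡ just v × ∃ λ a → Adj G v a × ((a ≡ p × xs ≡ [ v ]) ⊎ a ∈ xs)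
  leaf-on-path p (x ∷ [])     (here refl) u l = refl , p , Adj-sym G (head l) , inj₁ (refl , refl)
    where
    head : Linked (Adj G) (p ∷ v ∷ []) → Adj G p v
    head (r ∷ _) = r
  leaf-on-path p (x ∷ y ∷ xs) (here refl) ((_ ∷ p≢y ∷ _) ∷ _) (pv ∷ vy ∷ _) =
    contradiction (leaf (Adj-sym G pv) vy) p≢y
  leaf-on-path p (x ∷ y ∷ xs) (there v∈) (_ ∷ u) (_ ∷ l) with leaf-on-path x (y ∷ xs) v∈ u l
  ... | eq , a , va , inj₁ (refl , _) = eq , a , va , inj₂ (here refl)
  ... | eq , a , va , inj₂ a∈         = eq , a , va , inj₂ (there a∈)

  -- At `v₀` the first and last vertex of `rest` would be equal neighbours. Elsewhere `v` must be
  -- the last vertex, and its predecessor would coincide with `v₀` through the closing edge.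
  leaf∉cycle : (C : Cycle G) → v ∉ Cycle.v₀ C ∷ Cycle.rest C
  leaf∉cycle record { v₀ = v₀ ; rest = x ∷ y ∷ xs ; distinct = _ ∷ x∉ ∷ _ ; path = vx ∷ _ ; closing = closing } (here refl)
    with last-∃ y xs
  ... | w , eq = All.lookup x∉ (last-∈ (y ∷ xs) eq) (leaf vx (Adj-sym G (closing w eq)))
  leaf∉cycle record { rest = [] ; long = () } (here refl)
  leaf∉cycle record { rest = _ ∷ [] ; long = s≤s () } (here refl)
  leaf∉cycle record { v₀ = v₀ ; rest = xs ; long = long ; distinct = u@(v₀∉ ∷ _) ; path = path ; closing = closing } (there v∈)
    with leaf-on-path v₀ xs v∈ u path
  ... | eq , a , va , inj₂ a∈         = All.lookup v₀∉ a∈ (leaf (closing v eq) va)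
  ... | eq , a , va , inj₁ (_ , refl) with long
  ...   | s≤s ()

module AddEdge (G : Graph n) {v u : Fin n} (v≢u : v ≢ u) where

  edge : Fin n → Fin n → Bool
  edge i j = (does (v ≟ i) ∧ does (u ≟ j)) ∨ (does (u ≟ i) ∧ does (v ≟ j))

  edge-irrefl : ∀ i → edge i i ≡ false
  edge-irrefl i with v ≟ i | u ≟ i
  ... | yes refl | yes refl = contradiction refl v≢u
  ... | yes _    | no _     = refl
  ... | no _     | yes _    = refl
  ... | no _     | no _     = refl

  edge-sym : ∀ i j → edge i j ≡ edge j i
  edge-sym i j = trans (𝔹.∨-comm (does (v ≟ i) ∧ does (u ≟ j)) _)
    (cong₂ _∨_ (𝔹.∧-comm (does (u ≟ i)) _) (𝔹.∧-comm (does (v ≟ i)) _))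

  addEdge : Graph n
  addEdge = record
    { adj    = λ i j → adj G i j ∨ edge i j
    ; sym    = λ i j → cong₂ _∨_ (Graph.sym G i j) (edge-sym i j)
    ; irrefl = λ i → cong₂ _∨_ (irrefl G i) (edge-irrefl i)
    }

  Adj-old : ∀ {i j} → Adj G i j → Adj addEdge i j
  Adj-old ij rewrite ij = refl

  Adj-new : Adj addEdge v u
  Adj-new rewrite dec-true (v ≟ v) refl | dec-true (u ≟ u) refl = 𝔹.∨-zeroʳ (adj G v u)

  Adj-inv : ∀ {i j} → Adj addEdge i j → Adj G i j ⊎ (i ≡ v × j ≡ u) ⊎ (i ≡ u × j ≡ v)
  Adj-inv {i} {j} ij with ≡true∨≡false (adj G i j)
  ... | inj₁ old = inj₁ old
  ... | inj₂ eq rewrite eq with v ≟ i | u ≟ j | u ≟ i | v ≟ j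
  ...   | yes refl | yes refl | _        | _        = inj₂ (inj₁ (refl , refl))
  ...   | _        | _        | yes refl | yes refl = inj₂ (inj₂ (refl , refl))
  Adj-inv () | inj₂ eq | yes _ | no _ | yes _ | no _
  Adj-inv () | inj₂ eq | yes _ | no _ | no _  | _
  Adj-inv () | inj₂ eq | no _  | _    | yes _ | no _
  Adj-inv () | inj₂ eq | no _  | _    | no _  | _

  module _ (v-isolated : Isolated G v) where

    Adj-v : ∀ {i} → Adj addEdge v i → i ≡ u
    Adj-v vi with Adj-inv vi
    ... | inj₁ old               = contradiction old (¬Adj-isolated {G = G} v-isolated)
    ... | inj₂ (inj₁ (_ , i≡u)) = i≡u
    ... | inj₂ (inj₂ (v≡u , _)) = contradiction v≡u v≢u

    Adj-off-v : ∀ {i j} → i ≢ v → j ≢ v → Adj addEdge i j → Adj G i j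
    Adj-off-v i≢v j≢v ij with Adj-inv ij
    ... | inj₁ old               = old
    ... | inj₂ (inj₁ (i≡v , _)) = contradiction i≡v i≢v
    ... | inj₂ (inj₂ (_ , j≡v)) = contradiction j≡v j≢v

    -- The vertex `v` now has `u` as its only neighbour, so cycles avoid it and already exist in
    -- `G`.
    addEdge-forest : IsForest G → IsForest addEdge
    addEdge-forest forest C = forest record
      { v₀       = v₀
      ; rest     = rest
      ; long     = long
      ; distinct = distinct
      ; path     = Linked-map-∈ (λ x∈ y∈ → Adj-off-v (≢v x∈) (≢v y∈)) path
      ; closing  = λ w eq → Adj-off-v (≢v (there (last-∈ rest eq))) (≢v (here refl)) (closing w eq)
      }
      where
      open Cycle C
      ≢v : ∀ {x} → x ∈ v₀ ∷ rest → x ≢ v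
      ≢v x∈ refl = leaf∉cycle (λ va vb → trans (Adj-v va) (≡.sym (Adj-v vb))) C x∈

    isolated-addEdge : ∀ {x} → x ≢ v → x ≢ u → Isolated G x → Isolated addEdge x
    isolated-addEdge {x} x≢v x≢u iso y
      rewrite iso y | dec-false (v ≟ x) (≡.≢-sym x≢v) | dec-false (u ≟ x) (≡.≢-sym x≢u) = refl

    deg-addEdge : ∀ x → deg addEdge x ≡ deg G x + (𝟙 (does (v ≟ x)) + 𝟙 (does (u ≟ x)))
    deg-addEdge x = begin
      deg addEdge x
        ≡⟨ deg≡degIn addEdge x ⟩
      ∑ (allFin n) (λ j → 𝟙 (adj G x j ∨ edge x j))
        ≡⟨ ∑-cong (allFin n) (λ {j} _ → term x j) ⟩
      ∑ (allFin n) (λ j → 𝟙 (adj G x j) + (a * 𝟙 (does (u ≟ j)) + b * 𝟙 (does (v ≟ j))))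
        ≡⟨ trans (∑-+ (λ j → 𝟙 (adj G x j)) (λ j → a * 𝟙 (does (u ≟ j)) + b * 𝟙 (does (v ≟ j))) (allFin n))
             (cong₂ _+_ (≡.sym (deg≡degIn G x)) (∑-+ (λ j → a * 𝟙 (does (u ≟ j))) (λ j → b * 𝟙 (does (v ≟ j))) (allFin n))) ⟩
      deg G x + (∑ (allFin n) (λ j → a * 𝟙 (does (u ≟ j))) + ∑ (allFin n) (λ j → b * 𝟙 (does (v ≟ j))))
        ≡⟨ cong (deg G x +_) (cong₂ _+_ (total a u) (total b v)) ⟩
      deg G x + (a + b) ∎
      where
      open ≡-Reasoning
      a = 𝟙 (does (v ≟ x))
      b = 𝟙 (does (u ≟ x))
      total : ∀ k i → ∑ (allFin n) (λ j → k * 𝟙 (does (i ≟ j))) ≡ k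
      total k i = trans (∑-*ˡ k (λ j → 𝟙 (does (i ≟ j))) (allFin n)) (trans (cong (k *_) (∑-δ i)) (*-identityʳ k))
      𝟙-∨-false : ∀ c → 𝟙 (c ∨ false) ≡ 𝟙 c + 0
      𝟙-∨-false c = trans (cong 𝟙 (𝔹.∨-identityʳ c)) (≡.sym (+-identityʳ (𝟙 c)))
      -- As `v` was isolated, the new edge was absent before, and the disjunction counts as a sum.
      term : ∀ x j → 𝟙 (adj G x j ∨ edge x j) ≡
        𝟙 (adj G x j) + (𝟙 (does (v ≟ x)) * 𝟙 (does (u ≟ j)) + 𝟙 (does (u ≟ x)) * 𝟙 (does (v ≟ j)))
      term x j with v ≟ x | u ≟ x
      ... | yes refl | yes refl = contradiction refl v≢u
      ... | yes refl | no _ rewrite v-isolated j = trans (𝟙-∨-false (does (u ≟ j))) (≡.sym (+-identityʳ _))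
      ... | no _ | no _ = 𝟙-∨-false (adj G x j)
      ... | no _ | yes refl with v ≟ j
      ...   | yes refl rewrite trans (Graph.sym G u v) (v-isolated u) = refl
      ...   | no _ = 𝟙-∨-false (adj G x j)

empty : Graph n
empty = record { adj = λ _ _ → false ; sym = λ _ _ → refl ; irrefl = λ _ → refl }

empty-forest : IsForest (empty {n})
empty-forest record { rest = _ ∷ _ ; path = () ∷ _ }

-- Growing a forest with a stack of open slots

module Construction {n : ℕ} (d : Fin n → ℕ) where

  private
    V = Fin n

  -- A vertex occurs in pool once for each of its future children.
  record State (todo pool : List V) : Set where
    field
      graph     : Graph n
      forest    : IsForest graph
      done      : List V
      perm      : done ++ todo ↭ allFin n
      isolated  : ∀ {v} → v ∈ todo → Isolated graph v
      degrees   : ∀ {x} → x ∈ done → deg graph x + ∑ pool (λ u → 𝟙 (does (u ≟ x))) ≡ d x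
      pool⊆done : ∀ {u} → u ∈ pool → u ∈ done
  open State

  deg-isolated : ∀ (G : Graph n) {v} → Isolated G v → deg G v ≡ 0
  deg-isolated G {v} iso = trans (deg≡degIn G v) (trans (∑-cong (allFin n) (λ {j} _ → cong 𝟙 (iso j)))
    (trans (∑-const 0 (allFin n)) (*-zeroʳ (length (allFin n)))))

  ∑-δ-∉ : ∀ {x : V} (pool : List V) → x ∉ pool → ∑ pool (λ u → 𝟙 (does (u ≟ x))) ≡ 0
  ∑-δ-∉ {x} pool x∉ = trans (∑-cong pool (λ {u} u∈ → cong 𝟙 (dec-false (u ≟ x) (λ { refl → x∉ u∈ }))))
    (trans (∑-const 0 pool) (*-zeroʳ (length pool)))

  module _ {todo pool} (s : State todo pool) where

    unique-all : Unique (done s ++ todo)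
    unique-all = Unique-resp-↭ (↭-sym (perm s)) (allFin⁺ n)

    done≢todo : ∀ {x y} → x ∈ done s → y ∈ todo → x ≢ y
    done≢todo = AllPairs-++⁻-cross unique-all

  todo-head : ∀ {v todo pool} (s : State (v ∷ todo) pool) → ∀ {x} → x ∈ todo → v ≢ x
  todo-head s = All.lookup (head (drop (done s) (unique-all s)))
    where
    drop : ∀ xs {ys : List V} → Unique (xs ++ ys) → Unique ys
    drop []       u       = u
    drop (x ∷ xs) (_ ∷ u) = drop xs u
    head : ∀ {x : V} {xs} → Unique (x ∷ xs) → All (x ≢_) xs
    head (x∉ ∷ _) = x∉

  -- A root opens all `d v` slots, whereas an attached vertex spends one unit of its degree on its
  -- parent.
  root : ∀ {v todo k} → State (v ∷ todo) [] → d v ≡ k → State todo (replicate k v)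
  root {v} {todo} {k} s dv = record
    { graph     = graph s
    ; forest    = forest s
    ; done      = v ∷ done s
    ; perm      = ↭-trans (↭-sym (shift v (done s) todo)) (perm s)
    ; isolated  = isolated s ∘ there
    ; degrees   = degrees′
    ; pool⊆done = λ u∈ → here (replicate-∈ k u∈)
    }
    where
    replicate-∈ : ∀ k {u} → u ∈ replicate k v → u ≡ v
    replicate-∈ (suc k) (here eq)  = eq
    replicate-∈ (suc k) (there u∈) = replicate-∈ k u∈
    degrees′ : ∀ {x} → x ∈ v ∷ done s →
      deg (graph s) x + ∑ (replicate k v) (λ u → 𝟙 (does (u ≟ x))) ≡ d x
    degrees′ (here refl) rewrite deg-isolated (graph s) (isolated s (here refl))
      | ∑-replicate (λ u → 𝟙 (does (u ≟ v))) k v | dec-true (v ≟ v) refl = trans (*-identityʳ k) (≡.sym dv)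
    degrees′ {x} (there x∈) rewrite ∑-replicate (λ u → 𝟙 (does (u ≟ x))) k v
      | dec-false (v ≟ x) (≡.≢-sym (done≢todo s x∈ (here refl))) | *-zeroʳ k = degrees s x∈

  module _ {v u todo pool} (s : State (v ∷ todo) (u ∷ pool)) where

    private
      u∈done : u ∈ done s
      u∈done = pool⊆done s (here refl)
      v≢u : v ≢ u
      v≢u = ≡.≢-sym (done≢todo s u∈done (here refl))
      v-isolated : Isolated (graph s) v
      v-isolated = isolated s (here refl)

    open AddEdge (graph s) v≢u

    -- New slots go in front, so the pool is a stack and the next vertex hangs from `v` if `v` has a
    -- slot. This makes a leaf placed right after an internal vertex its neighbour.
    attach : ∀ {k} → d v ≡ suc k → State todo (replicate k v ++ pool)
    attach {k} dv = record
      { graph     = addEdge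
      ; forest    = addEdge-forest v-isolated (forest s)
      ; done      = v ∷ done s
      ; perm      = ↭-trans (↭-sym (shift v (done s) todo)) (perm s)
      ; isolated  = λ x∈ → isolated-addEdge v-isolated (≡.≢-sym (todo-head s x∈))
                      (≡.≢-sym (done≢todo s u∈done (there x∈))) (isolated s (there x∈))
      ; degrees   = degrees′
      ; pool⊆done = pool⊆done′ k
      }
      where
      pool⊆done′ : ∀ k {x} → x ∈ replicate k v ++ pool → x ∈ v ∷ done s
      pool⊆done′ zero    x∈          = there (pool⊆done s (there x∈))
      pool⊆done′ (suc k) (here refl) = here refl
      pool⊆done′ (suc k) (there x∈)  = pool⊆done′ k x∈
      open-slots : ∀ x → ∑ (replicate k v ++ pool) (λ w → 𝟙 (does (w ≟ x))) ≡
        k * 𝟙 (does (v ≟ x)) + ∑ pool (λ w → 𝟙 (does (w ≟ x)))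
      open-slots x = trans (∑-++ _ (replicate k v) pool) (cong (_+ ∑ pool (λ w → 𝟙 (does (w ≟ x)))) (∑-replicate (λ w → 𝟙 (does (w ≟ x))) k v))
      degrees′ : ∀ {x} → x ∈ v ∷ done s → deg addEdge x + ∑ (replicate k v ++ pool) (λ w → 𝟙 (does (w ≟ x))) ≡ d x
      degrees′ (here refl) rewrite deg-addEdge v-isolated v | open-slots v | deg-isolated (graph s) v-isolated
        | dec-true (v ≟ v) refl | dec-false (u ≟ v) (≡.≢-sym v≢u)
        = trans (cong (λ m → suc (k * 1 + m)) (∑-δ-∉ pool v∉pool))
            (≡.sym (trans dv (cong suc (≡.sym (trans (+-identityʳ (k * 1)) (*-identityʳ k))))))
        where
        v∉pool : v ∉ pool
        v∉pool v∈ = done≢todo s (pool⊆done s (there v∈)) (here refl) refl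
      degrees′ {x} (there x∈) rewrite deg-addEdge v-isolated x | open-slots x
        | dec-false (v ≟ x) (≡.≢-sym (done≢todo s x∈ (here refl))) | *-zeroʳ k
        = trans (+-assoc (deg (graph s) x) _ _) (degrees s x∈)

    module _ {k} (dv : d v ≡ suc k) where

      attach-old : ∀ {i j} → Adj (graph s) i j → Adj (graph (attach dv)) i j
      attach-old = Adj-old

      attach-new : Adj (graph (attach dv)) v u
      attach-new = Adj-new

-- Packings of closed neighbourhoods and the lower bound

module Packing {n : ℕ} (d : Fin n → ℕ) where

  open Construction d
  open State

  private
    V = Fin n

  -- Disjoint blocks, each containing the closed neighbourhood of one of its vertices
  -- as soon as the degrees are those prescribed by d.
  data Blocks (G : Graph n) : List V → ℕ → Set where
    []     : Blocks G [] 0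
    skip   : ∀ {v vs k} → Blocks G vs k → Blocks G (v ∷ vs) k
    pair   : ∀ {l v vs k} → Adj G l v → d l ≡ 1 → Blocks G vs k → Blocks G (l ∷ v ∷ vs) (suc k)
    triple : ∀ {x y z vs k} → Adj G y x → Adj G z y → d y ≡ 2 → Blocks G vs k → Blocks G (z ∷ y ∷ x ∷ vs) (suc k)

  Blocks-mono : ∀ {G H vs k} → (∀ {i j} → Adj G i j → Adj H i j) → Blocks G vs k → Blocks H vs k
  Blocks-mono G⊆H []                   = []
  Blocks-mono G⊆H (skip b)             = skip (Blocks-mono G⊆H b)
  Blocks-mono G⊆H (pair lv dl b)       = pair (G⊆H lv) dl (Blocks-mono G⊆H b)
  Blocks-mono G⊆H (triple yx zy dy b)  = triple (G⊆H yx) (G⊆H zy) dy (Blocks-mono G⊆H b)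

  module _ {G : Graph n} (degs : HasDegSeq G d) {D : Subset n} (dom : Dominating G D) where

    private
      χ : V → ℕ
      χ v = 𝟙 (Vec.lookup D v)

      χ∈ : ∀ {v} → v ∈ₛ D → 1 ≤ χ v
      χ∈ v∈ rewrite []=⇒lookup v∈ = ≤-refl

      degIn-all : ∀ v → degIn G (allFin n) v ≡ d v
      degIn-all v = trans (≡.sym (deg≡degIn G v)) (degs v)

      leaf : ∀ {l u v} → d l ≡ 1 → Adj G l u → Adj G l v → u ≡ v
      leaf {l} dl lu lv = neighbour-unique G (≤-reflexive (trans (degIn-all l) dl)) (∈-allFin _) (∈-allFin _) lu lv

      -- Three distinct neighbours would contribute three to the degree of `y`.
      two : ∀ {y x z u} → d y ≡ 2 → x ≢ z → Adj G y x → Adj G y z → Adj G y u → u ≡ x ⊎ u ≡ z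
      two {y} {x} {z} {u} dy x≢z yx yz yu with u ≟ x | u ≟ z
      ... | yes u≡x | _       = inj₁ u≡x
      ... | no _    | yes u≡z = inj₂ u≡z
      ... | no u≢x  | no u≢z  = contradiction three≤2 λ { (s≤s (s≤s ())) }
        where
        open ≤-Reasoning
        δ : V → V → ℕ
        δ i t = 𝟙 (does (i ≟ t))
        term : ∀ t → δ u t + (δ x t + δ z t) ≤ 𝟙 (adj G y t)
        term t with u ≟ t | x ≟ t | z ≟ t
        ... | yes refl | yes refl | _        = contradiction refl u≢x
        ... | yes refl | no _     | yes refl = contradiction refl u≢z
        ... | no _     | yes refl | yes refl = contradiction refl x≢z
        ... | yes refl | no _     | no _     rewrite yu = ≤-refl
        ... | no _     | yes refl | no _     rewrite yx = ≤-refl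
        ... | no _     | no _     | yes refl rewrite yz = ≤-refl
        ... | no _     | no _     | no _     = z≤n
        three≤2 : 3 ≤ 2
        three≤2 = begin
          3                                                       ≡⟨ cong₂ _+_ (≡.sym (∑-δ u)) (cong₂ _+_ (≡.sym (∑-δ x)) (≡.sym (∑-δ z))) ⟩
          ∑ (allFin n) (δ u) + (∑ (allFin n) (δ x) + ∑ (allFin n) (δ z)) ≡⟨ cong (∑ (allFin n) (δ u) +_) (≡.sym (∑-+ (δ x) (δ z) (allFin n))) ⟩
          ∑ (allFin n) (δ u) + ∑ (allFin n) (λ t → δ x t + δ z t) ≡⟨ ≡.sym (∑-+ (δ u) (λ t → δ x t + δ z t) (allFin n)) ⟩
          ∑ (allFin n) (λ t → δ u t + (δ x t + δ z t))            ≤⟨ ∑-mono (allFin n) (λ {t} _ → term t) ⟩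
          degIn G (allFin n) y                                    ≡⟨ trans (degIn-all y) dy ⟩
          2                                                       ∎

    -- A dominating set meets every closed neighbourhood: that of the leaf in a pair, that of the
    -- middle vertex in a triple. The blocks are disjoint because `vs` has no repetitions.
    blocks≤∑ : ∀ {vs k} → Unique vs → Blocks G vs k → k ≤ ∑ vs χ
    blocks≤∑ u [] = z≤n
    blocks≤∑ (_ ∷ u) (skip {v} b) = ≤-trans (blocks≤∑ u b) (m≤n+m _ (χ v))
    blocks≤∑ (_ ∷ _ ∷ u) (pair {l} {v} {vs} lv dl b) =
      ≤-trans (+-mono-≤ hit (blocks≤∑ u b)) (≤-reflexive (+-assoc (χ l) (χ v) _))
      where
      hit : 1 ≤ χ l + χ v
      hit with dom l
      ... | inj₁ l∈ = ≤-trans (χ∈ l∈) (m≤m+n _ _)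
      ... | inj₂ (w , w∈ , lw) rewrite leaf dl lw lv = ≤-trans (χ∈ w∈) (m≤n+m _ (χ l))
    blocks≤∑ ((_ ∷ z≢x ∷ _) ∷ _ ∷ _ ∷ u) (triple {x} {y} {z} {vs} yx zy dy b) =
      ≤-trans (+-mono-≤ hit (blocks≤∑ u b)) (≤-reflexive (reassoc (χ z) (χ y) (χ x) _))
      where
      reassoc : ∀ a b c e → a + (b + c) + e ≡ a + (b + (c + e))
      reassoc = solve-∀
      hit : 1 ≤ χ z + (χ y + χ x)
      hit with dom y
      ... | inj₁ y∈ = ≤-trans (χ∈ y∈) (≤-trans (m≤m+n (χ y) (χ x)) (m≤n+m _ (χ z)))
      ... | inj₂ (w , w∈ , yw) with two dy (≡.≢-sym z≢x) yx (Adj-sym G zy) yw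
      ...   | inj₁ refl = ≤-trans (χ∈ w∈) (≤-trans (m≤n+m (χ x) (χ y)) (m≤n+m _ (χ z)))
      ...   | inj₂ refl = ≤-trans (χ∈ w∈) (m≤m+n (χ z) _)

  -- `p` counts open slots and `k` counts blocks; later arguments need only these numbers, not the
  -- pool itself.
  record Built (todo : List V) (p k : ℕ) : Set where
    constructor built
    field
      {pool} : List V
      size   : length pool ≡ p
      state  : State todo pool
      blocks : Blocks (graph state) (done state) k

  private
    length-slots : ∀ k {v p} {pool : List V} → length pool ≡ p → length (replicate k v ++ pool) ≡ k + p
    length-slots zero    eq = eq
    length-slots (suc k) eq = cong suc (length-slots k eq)

  add-one : ∀ {v todo p j k} → d v ≡ suc j → Built (v ∷ todo) (suc p) k → Built todo (j + p) k
  add-one {j = j} dv (built {_ ∷ _} size s b) =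
    built (length-slots j (ℕ.suc-injective size)) (attach s dv) (skip (Blocks-mono (attach-old s dv) b))

  -- One slot goes to `v`, which opens `suc j`; the top one of these is taken by `l`.
  add-pair : ∀ {v l todo p j k} → d v ≡ suc (suc j) → d l ≡ 1 →
    Built (v ∷ l ∷ todo) (suc p) k → Built todo (j + p) (suc k)
  add-pair {j = j} dv dl (built {_ ∷ _} size s b) =
    built (length-slots j (ℕ.suc-injective size)) s₂
      (pair (attach-new s₁ dl) dl (Blocks-mono {graph s₁} (attach-old s₁ dl) (Blocks-mono (attach-old s dv) b)))
    where
    s₁ = attach s dv
    s₂ = attach s₁ dl

  -- For `j` zero this is a component K₂.
  add-root-pair : ∀ {v l todo j k} → d v ≡ suc j → d l ≡ 1 →
    Built (v ∷ l ∷ todo) 0 k → Built todo j (suc k)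
  add-root-pair {j = j} dv dl (built {[]} size s b) =
    built (ListP.length-replicate j) s₂ (pair (attach-new s₁ dl) dl (Blocks-mono (attach-old s₁ dl) b))
    where
    s₁ = root s dv
    s₂ = attach s₁ dl

  -- Each vertex hangs from the preceding one, so `x` and `z` are the two neighbours of `y`.
  add-triple : ∀ {x y z todo p k} → d x ≡ 2 → d y ≡ 2 → d z ≡ 2 →
    Built (x ∷ y ∷ z ∷ todo) (suc p) k → Built todo (suc p) (suc k)
  add-triple dx dy dz (built {_ ∷ _} size s b) =
    built size s₃ (triple (attach-old s₂ dz (attach-new s₁ dy)) (attach-new s₂ dz) dy
      (Blocks-mono {graph s₂} (attach-old s₂ dz) (Blocks-mono {graph s₁} (attach-old s₁ dy) (Blocks-mono (attach-old s dx) b))))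
    where
    s₁ = attach s dx
    s₂ = attach s₁ dy
    s₃ = attach s₂ dz

  flat : List (V × V) → List V
  flat []             = []
  flat ((v , l) ∷ ps) = v ∷ l ∷ flat ps

  -- A vertex of degree 2 closes one slot and opens one, so the number of open slots survives. At
  -- most two vertices at the end belong to no triple.
  add-chain : ∀ xs {todo p k} → All (λ x → d x ≡ 2) xs → Built (xs ++ todo) (suc p) k →
    ∃ λ q → length xs ≤ 3 * q + 2 × Built todo (suc p) (q + k)
  add-chain []           []       b = 0 , z≤n , b
  add-chain (x ∷ [])     (dx ∷ []) b = 0 , s≤s z≤n , add-one dx b
  add-chain (x ∷ y ∷ []) (dx ∷ dy ∷ []) b = 0 , s≤s (s≤s z≤n) , add-one dy (add-one dx b)
  add-chain (x ∷ y ∷ z ∷ xs) {k = k} (dx ∷ dy ∷ dz ∷ ds) b with add-chain xs ds (add-triple dx dy dz b)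
  ... | q , le , b′ = suc q , ≤-trans (+-monoʳ-≤ 3 le) (≤-reflexive (shift-3 q)) , subst (Built _ _) (+-suc q k) b′
    where
    shift-3 : ∀ q → 3 + (3 * q + 2) ≡ 3 * suc q + 2
    shift-3 = solve-∀

  LeafPair : V × V → Set
  LeafPair (v , l) = 2 ≤ d v × d l ≡ 1

  -- In the next lemmas r is the number of components still to be started; p + 2 r = e
  -- says that the e remaining leaves fill the p open slots and r components K₂.
  add-pairs-2 : ∀ ps {todo p k} r e → All (λ q → d (proj₁ q) ≡ 2 × d (proj₂ q) ≡ 1) ps → p ≤ 1 →
    p + 2 * r ≡ length ps + e → Built (flat ps ++ todo) p k →
    ∃₂ λ p′ r′ → p′ + 2 * r′ ≡ e × p′ ≤ 1 × Built todo p′ (length ps + k)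
  add-pairs-2 [] {p = p} r e [] p≤1 eq b = p , r , eq , p≤1 , b
  add-pairs-2 ((v , l) ∷ ps) {p = suc zero} {k} r e ((dv , dl) ∷ ds) p≤1 eq b
    with add-pairs-2 ps r e ds z≤n (ℕ.suc-injective eq) (add-pair dv dl b)
  ... | p′ , r′ , eq′ , p′≤1 , b′ = p′ , r′ , eq′ , p′≤1 , subst (Built _ _) (+-suc (length ps) k) b′
  add-pairs-2 ((v , l) ∷ ps) {p = suc (suc p)} r e ds (s≤s ()) eq b
  -- With no open slot the equation forces `r` to be positive. The new component leaves one slot,
  -- which the next pair uses up.
  add-pairs-2 ((v , l) ∷ ps) {p = zero} {k} (suc r) e ((dv , dl) ∷ ds) p≤1 eq b
    with add-pairs-2 ps r e ds ≤-refl (ℕ.suc-injective (trans (≡.sym (*-suc 2 r)) eq)) (add-root-pair dv dl b)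
  ... | p′ , r′ , eq′ , p′≤1 , b′ = p′ , r′ , eq′ , p′≤1 , subst (Built _ _) (+-suc (length ps) k) b′

  Sorted : List (V × V) → Set
  Sorted = AllPairs (λ q q′ → d (proj₁ q′) ≤ d (proj₁ q))

  ∑d : List (V × V) → ℕ
  ∑d ps = ∑ ps (λ q → d (proj₁ q))

  -- The pool can only run empty at a vertex of degree 2; since the degrees do not
  -- increase, all later ones are then 2 as well.
  add-pairs : ∀ ps {todo p k} r e → All LeafPair ps → Sorted ps →
    suc p + ∑d ps + 2 * r ≡ 3 * length ps + e → Built (flat ps ++ todo) (suc p) k →
    ∃₂ λ p′ r′ → p′ + 2 * r′ ≡ e × (r′ ≡ r ⊎ p′ ≤ 1) × Built todo p′ (length ps + k)
  add-pairs [] {p = p} r e [] [] eq b = suc p , r , trans (cong (λ m → suc m + 2 * r) (≡.sym (+-identityʳ p))) eq , inj₁ refl , b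
  add-pairs ((v , l) ∷ ps) {p = p} {k} r e ((2≤dv , dl) ∷ ds) (v≥ ∷ sorted) eq b with d v in dv
  add-pairs ((v , l) ∷ ps) r e ((s≤s () , dl) ∷ ds) (v≥ ∷ sorted) eq b | suc zero
  ... | suc (suc j) with j + p in j+p | add-pair {p = p} dv dl b
  ...   | suc p₁ | b₁ with add-pairs ps r e ds sorted eq₁ b₁
    where
    reduce : ∀ j p s t m e → suc p + (suc (suc j) + s) + t ≡ 3 * suc m + e → j + p + s + t ≡ 3 * m + e
    reduce j p s t m e h = +-cancelˡ-≡ 3 _ _ (trans (lhs j p s t) (trans h (rhs m e)))
      where
      lhs : ∀ j p s t → 3 + (j + p + s + t) ≡ suc p + (suc (suc j) + s) + t
      lhs = solve-∀
      rhs : ∀ m e → 3 * suc m + e ≡ 3 + (3 * m + e)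
      rhs = solve-∀
    eq₁ : suc p₁ + ∑d ps + 2 * r ≡ 3 * length ps + e
    eq₁ = subst (λ m → m + ∑d ps + 2 * r ≡ 3 * length ps + e) j+p (reduce j p (∑d ps) (2 * r) (length ps) e eq)
  ...     | p′ , r′ , eq′ , alt , b′ = p′ , r′ , eq′ , alt , subst (Built _ _) (+-suc (length ps) k) b′
  add-pairs ((v , l) ∷ ps) {p = p} {k} r e ((2≤dv , dl) ∷ ds) (v≥ ∷ sorted) eq b | suc (suc j) | zero | b₁
    with m+n≡0⇒m≡0 j j+p | m+n≡0⇒n≡0 j j+p
  ... | refl | refl with add-pairs-2 ps r e twos z≤n eq₂ b₁
    where
    twos : All (λ q → d (proj₁ q) ≡ 2 × d (proj₂ q) ≡ 1) ps
    twos = All.zipWith (λ { ((2≤ , dl′) , ≤2) → ≤-antisym ≤2 2≤ , dl′ }) (ds , v≥)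
    sum-twos : ∑d ps ≡ length ps * 2
    sum-twos = trans (∑-cong ps (λ q∈ → proj₁ (All.lookup twos q∈))) (∑-const 2 ps)
    cancel : ∀ m t e → 1 + (2 + m * 2) + t ≡ 3 * suc m + e → t ≡ m + e
    cancel m t e h = +-cancelˡ-≡ (3 + m * 2) _ _ (trans (lhs m t) (trans h (rhs m e)))
      where
      lhs : ∀ m t → 3 + m * 2 + t ≡ 1 + (2 + m * 2) + t
      lhs = solve-∀
      rhs : ∀ m e → 3 * suc m + e ≡ 3 + m * 2 + (m + e)
      rhs = solve-∀
    -- With all remaining degrees equal to 2 and the pool empty, the slot equation becomes the
    -- hypothesis of `add-pairs-2`.
    eq₂ : 2 * r ≡ length ps + e
    eq₂ = cancel (length ps) (2 * r) e (trans (cong (λ m → 1 + (2 + m) + 2 * r) (≡.sym sum-twos)) eq)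
  ...   | p′ , r′ , eq′ , p′≤1 , b′ = p′ , r′ , eq′ , inj₂ p′≤1 , subst (Built _ _) (+-suc (length ps) k) b′

  -- The first `p` leaves fill the open slots; the others pair up into `r` components K₂, each a
  -- block.
  add-leaves : ∀ ls {p k} r → All (λ l → d l ≡ 1) ls → p + 2 * r ≡ length ls → Built ls p k → Built [] 0 (r + k)
  add-leaves []       {zero}  zero    []        eq b = b
  add-leaves (l ∷ ls) {suc p} r       (dl ∷ ds) eq b = add-leaves ls r ds (ℕ.suc-injective eq) (add-one dl b)
  add-leaves (a ∷ ls) {zero}  (suc r) (da ∷ ds) eq b with trans (≡.sym (*-suc 2 r)) eq
  add-leaves (a ∷ l ∷ ls) {zero} {k} (suc r) (da ∷ dl ∷ ds) eq b | eq′ =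
    subst (Built [] 0) (+-suc r k)
      (add-leaves ls r ds (ℕ.suc-injective (ℕ.suc-injective eq′)) (add-root-pair da dl b))

  start : ∀ {todo} → todo ↭ allFin n → Built todo 0 0
  start p = built {pool = []} refl record
    { graph = empty ; forest = empty-forest ; done = [] ; perm = p
    ; isolated = λ _ _ → refl ; degrees = λ () ; pool⊆done = λ () } []

  -- Only the lower bound is recorded; a small dominating set comes from the upper bounds, which
  -- hold for every realisation.
  Realised : ℕ → Set
  Realised k = ∃ λ F → IsForest F × HasDegSeq F d × (∀ D → Dominating F D → k ≤ ∣ D ∣)

  -- Without open slots the degree invariant gives the prescribed degrees, under which the blocks
  -- bound every dominating set.
  finish : ∀ {k} → Built [] 0 k → Realised k
  finish (built {[]} size s b) = graph s , forest s , degs , λ D dom →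
    ≤-trans (blocks≤∑ degs dom unique-done b) (≤-reflexive (trans (∑-↭ _ done↭) (≡.sym (∣∣≡∑ D))))
    where
    done↭ : done s ↭ allFin n
    done↭ = subst (_↭ allFin n) (ListP.++-identityʳ (done s)) (perm s)
    unique-done : Unique (done s)
    unique-done = Unique-resp-↭ (↭-sym done↭) (allFin⁺ n)
    degs : HasDegSeq (graph s) d
    degs x = trans (≡.sym (+-identityʳ _)) (degrees s (∈-resp-↭ (↭-sym done↭) (∈-allFin x)))

  -- The first pair is the root: it accounts for one component and one block, and as `d v` is at
  -- least 2 it leaves a slot for the chain. Then `c` counts the components still to be started.
  realisation : ∀ v l ps xs ls c → v ∷ l ∷ xs ++ flat ps ++ ls ↭ allFin n →
    All LeafPair ((v , l) ∷ ps) → Sorted ((v , l) ∷ ps) → All (λ x → d x ≡ 2) xs → All (λ l → d l ≡ 1) ls →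
    ∑d ((v , l) ∷ ps) + 2 * suc c ≡ 3 * suc (length ps) + length ls →
    ∃₂ λ p r → ∃ λ q → p + 2 * r ≡ length ls × (r ≡ c ⊎ p ≤ 1) × length xs ≤ 3 * q + 2 ×
      Realised (r + (length ps + (q + 1)))
  realisation v l ps xs ls c perm ((2≤dv , dl) ∷ ds) (_ ∷ sorted) twos leaves eq with d v in dv
  realisation v l ps xs ls c perm ((s≤s () , dl) ∷ ds) (_ ∷ sorted) twos leaves eq | suc zero
  ... | suc (suc j) with add-chain xs twos (add-root-pair dv dl (start perm))
  ...   | q , le , b with add-pairs ps c (length ls) ds sorted (reduce j _ c (length ps) (length ls) eq) b
    where
    reduce : ∀ j s c m e → suc (suc j) + s + 2 * suc c ≡ 3 * suc m + e → suc j + s + 2 * c ≡ 3 * m + e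
    reduce j s c m e h = +-cancelˡ-≡ 3 _ _ (trans (lhs j s c) (trans h (rhs m e)))
      where
      lhs : ∀ j s c → 3 + (suc j + s + 2 * c) ≡ suc (suc j) + s + 2 * suc c
      lhs = solve-∀
      rhs : ∀ m e → 3 * suc m + e ≡ 3 + (3 * m + e)
      rhs = solve-∀
  ...     | p , r , eq′ , alt , b′ = p , r , q , eq′ , alt , le , finish (add-leaves ls r leaves eq′ b′)

-- Pairing internal vertices with leaves

filter-split : ∀ {P Q : A → Set} (P? : ∀ x → Dec (P x)) (Q? : ∀ x → Dec (Q x)) →
  (∀ x → does (Q? x) ≡ not (does (P? x))) → ∀ xs → filter P? xs ++ filter Q? xs ↭ xs
filter-split P? Q? compl []       = ↭-refl
filter-split P? Q? compl (x ∷ xs) with does (P? x) | does (Q? x) | compl x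
... | true  | .false | refl = prep x (filter-split P? Q? compl xs)
... | false | .true  | refl = ↭-trans (shift x (filter P? xs) (filter Q? xs)) (prep x (filter-split P? Q? compl xs))

match : ∀ (xs ys : List A) → ∃ λ ps → ∃₂ λ xs′ ys′ →
  xs ≡ map proj₁ ps ++ xs′ × ys ≡ map proj₂ ps ++ ys′ × (xs′ ≡ [] ⊎ ys′ ≡ [])
match []       ys       = [] , [] , ys , refl , refl , inj₁ refl
match (x ∷ xs) []       = [] , x ∷ xs , [] , refl , refl , inj₂ refl
match (x ∷ xs) (y ∷ ys) with match xs ys
... | ps , xs′ , ys′ , refl , refl , alt = (x , y) ∷ ps , xs′ , ys′ , refl , refl , alt

⌊/2⌋-≤ : ∀ {m k} → m ≤ 2 * k + 1 → ⌊ m /2⌋ ≤ k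
⌊/2⌋-≤ {m} {k} m≤ = ≤-trans (⌊n/2⌋-mono m≤) (≤-reflexive (half k))
  where
  half : ∀ k → ⌊ 2 * k + 1 /2⌋ ≡ k
  half zero    = refl
  half (suc k) = trans (cong (λ j → ⌊ j + 1 /2⌋) (*-suc 2 k)) (cong suc (half k))

≤-⌊/2⌋ : ∀ {m k} → 2 * k ≤ m → k ≤ ⌊ m /2⌋
≤-⌊/2⌋ {m} {k} le = ≤-trans (≤-reflexive (half k)) (⌊n/2⌋-mono le)
  where
  half : ∀ k → k ≡ ⌊ 2 * k /2⌋
  half zero    = refl
  half (suc k) = trans (cong suc (half k)) (cong ⌊_/2⌋ (≡.sym (*-suc 2 k)))

≤-⌈/2⌉ : ∀ {m k} → ⌈ m /2⌉ ≤ k → m ≤ 2 * k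
≤-⌈/2⌉ {m} {k} le = begin
  m                     ≡⟨ ≡.sym (⌊n/2⌋+⌈n/2⌉≡n m) ⟩
  ⌊ m /2⌋ + ⌈ m /2⌉     ≤⟨ +-mono-≤ (≤-trans (⌊n/2⌋≤⌈n/2⌉ m) le) le ⟩
  k + k                 ≡⟨ cong (k +_) (≡.sym (+-identityʳ k)) ⟩
  2 * k                 ∎
  where open ≤-Reasoning

-- Here `c` is one less than the number of components.
module DegreeSequence {n} (d : Fin n → ℕ) (c : ℕ) (1≤d : ∀ i → 1 ≤ d i) (noninc : ∀ i j → i ≤ᶠ j → d j ≤ d i)
                      (i₀ : Fin n) (2≤di₀ : 2 ≤ d i₀) (sum-eq : seqSum d + 2 * suc c ≡ 2 * n) where

  open Packing d

  private
    V = Fin n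
    I L : List V
    I = filter (λ j → 2 ≤? d j) (allFin n)
    L = filter (λ j → d j ℕ.≟ 1) (allFin n)
    m = count≥ 2 d
    ℓ = count= 1 d

  I++L↭ : I ++ L ↭ allFin n
  I++L↭ = filter-split (λ j → 2 ≤? d j) (λ j → d j ℕ.≟ 1) (λ j → leaf-or-internal (1≤d j)) (allFin n)
    where
    leaf-or-internal : ∀ {k} → 1 ≤ k → does (k ℕ.≟ 1) ≡ not (does (2 ≤? k))
    leaf-or-internal {suc zero}    _ = refl
    leaf-or-internal {suc (suc k)} _ = refl

  m+ℓ≡n : m + ℓ ≡ n
  m+ℓ≡n = trans (≡.sym (ListP.length-++ I)) (trans (↭-length I++L↭) (length-allFin n))

  all-I : All (λ v → 2 ≤ d v) I
  all-I = AllP.all-filter _ (allFin n)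

  all-L : All (λ v → d v ≡ 1) L
  all-L = AllP.all-filter _ (allFin n)

  ∑I : ∑ I d + ℓ + 2 * suc c ≡ 2 * (m + ℓ)
  ∑I = trans (cong (_+ 2 * suc c) ∑I+ℓ) (trans sum-eq (cong (2 *_) (≡.sym m+ℓ≡n)))
    where
    ∑L : ∑ L d ≡ ℓ
    ∑L = trans (∑-cong L (λ v∈ → All.lookup all-L v∈)) (trans (∑-const 1 L) (*-identityʳ ℓ))
    ∑I+ℓ : ∑ I d + ℓ ≡ seqSum d
    ∑I+ℓ = trans (cong (∑ I d +_) (≡.sym ∑L)) (trans (≡.sym (∑-++ d I L)) (∑-↭ d I++L↭))

  sorted-I : AllPairs (λ x y → d y ≤ d x) I
  sorted-I = AllPairsP.filter⁺ _ (AllPairsP.tabulate⁺-< (λ {i} {j} i<j → noninc i j (<⇒≤ i<j)))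

  ∑≥ : ∀ k {xs} → All (λ v → k ≤ d v) xs → length xs * k ≤ ∑ xs d
  ∑≥ k {xs} all = ≤-trans (≤-reflexive (≡.sym (∑-const k xs))) (∑-mono xs (λ v∈ → All.lookup all v∈))

  flat-↭ : ∀ xs ps ls → xs ++ flat ps ++ ls ↭ (map proj₁ ps ++ xs) ++ (map proj₂ ps ++ ls)
  flat-↭ xs []             ls = ↭-refl
  flat-↭ xs ((v , l) ∷ ps) ls =
    ↭-trans (shift v xs (l ∷ flat ps ++ ls)) (prep v
      (↭-trans (shift l xs (flat ps ++ ls))
        (↭-trans (prep l (flat-↭ xs ps ls)) (↭-sym (shift l (map proj₁ ps ++ xs) (map proj₂ ps ++ ls))))))

  module _ (ps : List (V × V)) (xs ls : List V)
           (I≡ : I ≡ map proj₁ ps ++ xs) (L≡ : L ≡ map proj₂ ps ++ ls) (alt : xs ≡ [] ⊎ ls ≡ []) where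

    private
      q = length ps

    m≡ : m ≡ q + length xs
    m≡ = trans (cong length I≡) (trans (ListP.length-++ (map proj₁ ps)) (cong (_+ length xs) (ListP.length-map proj₁ ps)))

    ℓ≡ : ℓ ≡ q + length ls
    ℓ≡ = trans (cong length L≡) (trans (ListP.length-++ (map proj₂ ps)) (cong (_+ length ls) (ListP.length-map proj₂ ps)))

    ∑I≡ : ∑ I d ≡ ∑d ps + ∑ xs d
    ∑I≡ = trans (cong (λ zs → ∑ zs d) I≡) (trans (∑-++ d (map proj₁ ps) xs) (cong (_+ ∑ xs d) (∑-map proj₁ d ps)))

    all-xs : All (λ v → 2 ≤ d v) xs
    all-xs = AllP.++⁻ʳ (map proj₁ ps) (subst (All _) I≡ all-I)

    all-ls : All (λ v → d v ≡ 1) ls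
    all-ls = AllP.++⁻ʳ (map proj₂ ps) (subst (All _) L≡ all-L)

    all-ps : All LeafPair ps
    all-ps = All.zip ( AllP.map⁻ (AllP.++⁻ˡ (map proj₁ ps) (subst (All _) I≡ all-I))
                     , AllP.map⁻ (AllP.++⁻ˡ (map proj₂ ps) (subst (All _) L≡ all-L)))

    sorted-I′ : AllPairs (λ x y → d y ≤ d x) (map proj₁ ps ++ xs)
    sorted-I′ = subst (AllPairs _) I≡ sorted-I

    sorted-ps : Sorted ps
    sorted-ps = AllPairsP.map⁻ (AllPairs-++⁻ˡ (map proj₁ ps) sorted-I′)

    perm : xs ++ flat ps ++ ls ↭ allFin n
    perm = ↭-trans (flat-↭ xs ps ls) (subst₂ (λ is ls → is ++ ls ↭ allFin n) I≡ L≡ I++L↭)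

    -- If an unpaired internal vertex had degree at least 3, so would all paired ones.
    twos : All (λ x → d x ≡ 2) xs
    twos = [ (λ xs≡[] → subst (All _) (≡.sym xs≡[]) []) , (λ ls≡[] → All.tabulate (two ls≡[])) ]′ alt
      where
      two : ls ≡ [] → ∀ {x} → x ∈ xs → d x ≡ 2
      two ls≡[] {x} x∈ with d x ℕ.≟ 2
      ... | yes dx≡2 = dx≡2
      ... | no  dx≢2 = contradiction (≤-trans (s≤s z≤n) too-many) λ ()
        where
        open ≤-Reasoning
        3≤dx : 3 ≤ d x
        3≤dx = ≤∧≢⇒< (All.lookup all-xs x∈) (≡.≢-sym dx≢2)
        3≤ps : All (λ v → 3 ≤ d v) (map proj₁ ps)
        3≤ps = All.tabulate (λ v∈ → ≤-trans 3≤dx (AllPairs-++⁻-cross sorted-I′ v∈ x∈))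
        lower : q * 3 + length xs * 2 ≤ ∑ I d
        lower = begin
          q * 3 + length xs * 2                         ≡⟨ cong (λ k → k * 3 + length xs * 2) (≡.sym (ListP.length-map proj₁ ps)) ⟩
          length (map proj₁ ps) * 3 + length xs * 2     ≤⟨ +-mono-≤ (∑≥ 3 3≤ps) (∑≥ 2 all-xs) ⟩
          ∑ (map proj₁ ps) d + ∑ xs d                   ≡⟨ cong (_+ ∑ xs d) (∑-map proj₁ d ps) ⟩
          ∑d ps + ∑ xs d                                ≡⟨ ≡.sym ∑I≡ ⟩
          ∑ I d                                         ∎
        ℓ≡q : ℓ ≡ q
        ℓ≡q = trans ℓ≡ (trans (cong (λ ls → q + length ls) ls≡[]) (+-identityʳ q))
        shuffle : ∀ q x → 2 * (q + x + q) ≡ q * 3 + x * 2 + q + 0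
        shuffle = solve-∀
        -- The degree sum would reach `3 q + 2 x + q`, with `x` the length of `xs`. That equals
        -- `2 n`, which leaves nothing for the components.
        too-many : 2 * suc c ≤ 0
        too-many = +-cancelˡ-≤ (q * 3 + length xs * 2 + q) _ _ (begin
          q * 3 + length xs * 2 + q + 2 * suc c         ≤⟨ +-monoˡ-≤ (2 * suc c) (+-mono-≤ lower (≤-reflexive (≡.sym ℓ≡q))) ⟩
          ∑ I d + ℓ + 2 * suc c                         ≡⟨ ∑I ⟩
          2 * (m + ℓ)                                   ≡⟨ cong₂ (λ a b → 2 * (a + b)) m≡ ℓ≡q ⟩
          2 * (q + length xs + q)                       ≡⟨ shuffle q (length xs) ⟩
          q * 3 + length xs * 2 + q + 0                 ∎)

    -- Unpaired internal vertices contribute 2 each on both sides and cancel. Subtracting the `ℓ`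
    -- leaves turns the `4 q` of the pairs into `3 q`.
    ∑d-pairs : ∑d ps + 2 * suc c ≡ 3 * q + length ls
    ∑d-pairs = +-cancelʳ-≡ (length xs * 2 + ℓ) _ _ (begin
      ∑d ps + 2 * suc c + (length xs * 2 + ℓ)           ≡⟨ shuffle₁ (∑d ps) (2 * suc c) (length xs * 2) ℓ ⟩
      ∑d ps + length xs * 2 + ℓ + 2 * suc c             ≡⟨ cong (λ s → s + ℓ + 2 * suc c) (trans (cong (∑d ps +_) (≡.sym ∑xs)) (≡.sym ∑I≡)) ⟩
      ∑ I d + ℓ + 2 * suc c                             ≡⟨ ∑I ⟩
      2 * (m + ℓ)                                       ≡⟨ cong₂ (λ a b → 2 * (a + b)) m≡ ℓ≡ ⟩
      2 * (q + length xs + (q + length ls))             ≡⟨ shuffle₂ q (length xs) (length ls) ⟩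
      3 * q + length ls + (length xs * 2 + (q + length ls)) ≡⟨ cong (λ b → 3 * q + length ls + (length xs * 2 + b)) (≡.sym ℓ≡) ⟩
      3 * q + length ls + (length xs * 2 + ℓ)           ∎)
      where
      open ≡-Reasoning
      ∑xs : ∑ xs d ≡ length xs * 2
      ∑xs = trans (∑-cong xs (λ x∈ → All.lookup twos x∈)) (∑-const 2 xs)
      shuffle₁ : ∀ s c x l → s + c + (x + l) ≡ s + x + l + c
      shuffle₁ = solve-∀
      shuffle₂ : ∀ q x k → 2 * (q + x + (q + k)) ≡ 3 * q + k + (x * 2 + (q + k))
      shuffle₂ = solve-∀

  -- There are q pairs of an internal vertex and a leaf; x internal vertices and k leaves
  -- remain. The blocks are the q pairs, t triples among the x vertices, and r components K₂.
  record Shape : Set where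
    field
      {q x k p r t} : ℕ
      m≡q+x    : m ≡ q + x
      ℓ≡q+k    : ℓ ≡ q + k
      x∨k      : x ≡ 0 ⊎ k ≡ 0
      p+2r≡k   : p + 2 * r ≡ k
      r∨p      : r ≡ c ⊎ p ≤ 1
      x≤3t+2   : x ≤ 3 * t + 2
      realised : Realised (r + q + t)

  abstract

    shape : Shape
    shape with match I L
    ... | (v , l) ∷ ps , xs , ls , I≡ , L≡ , alt
        with realisation v l ps xs ls c
               (↭-trans (↭-sym (↭-trans (shift v xs _) (prep v (shift l xs _)))) (perm ((v , l) ∷ ps) xs ls I≡ L≡ alt))
               (all-ps ((v , l) ∷ ps) xs ls I≡ L≡ alt) (sorted-ps ((v , l) ∷ ps) xs ls I≡ L≡ alt)
               (twos ((v , l) ∷ ps) xs ls I≡ L≡ alt) (all-ls ((v , l) ∷ ps) xs ls I≡ L≡ alt)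
               (∑d-pairs ((v , l) ∷ ps) xs ls I≡ L≡ alt)
    ...   | p , r , t , eq , r∨p , x≤ , real = record
      { m≡q+x    = m≡ ((v , l) ∷ ps) xs ls I≡ L≡ alt
      ; ℓ≡q+k    = ℓ≡ ((v , l) ∷ ps) xs ls I≡ L≡ alt
      ; x∨k      = Sum.map (cong length) (cong length) alt
      ; p+2r≡k   = eq
      ; r∨p      = r∨p
      ; x≤3t+2   = x≤
      ; realised = subst Realised (count r (length ps) t) real
      }
      where
      count : ∀ r q t → r + (q + (t + 1)) ≡ r + suc q + t
      count = solve-∀
    -- Without a pair one kind of vertex is missing: either internal vertices, against `i₀`, or
    -- leaves, and then the degree sum is at least `2 n`.
    shape | [] , xs , ls , I≡ , L≡ , inj₁ refl = contradiction (subst (i₀ ∈_) I≡ (∈-filter⁺ _ (∈-allFin i₀) 2≤di₀)) λ ()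
    shape | [] , xs , ls , I≡ , L≡ , inj₂ refl = contradiction (≤-trans (s≤s z≤n) no-leaf) λ ()
      where
      open ≤-Reasoning
      ℓ≡0 : ℓ ≡ 0
      ℓ≡0 = cong length L≡
      shuffle : ∀ m → 2 * (m + 0) ≡ m * 2 + 0
      shuffle = solve-∀
      no-leaf : 2 * suc c ≤ 0
      no-leaf = +-cancelˡ-≤ (m * 2) _ _ (begin
        m * 2 + 2 * suc c           ≤⟨ +-monoˡ-≤ (2 * suc c) (≤-trans (∑≥ 2 all-I) (m≤m+n _ ℓ)) ⟩
        ∑ I d + ℓ + 2 * suc c       ≡⟨ ∑I ⟩
        2 * (m + ℓ)                 ≡⟨ cong (λ z → 2 * (m + z)) ℓ≡0 ⟩
        2 * (m + 0)                 ≡⟨ shuffle m ⟩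
        m * 2 + 0                   ∎)

  -- Comparison of the two bounds in the three cases

  open Shape shape

  -- One forest needs at least `K` vertices and no forest needs more, so that forest attains the
  -- maximum.
  gamma-max : ∀ {K} → K ≤ r + q + t →
    (∀ F → IsForest F → HasDegSeq F d → ∃ λ D → Dominating F D × ∣ D ∣ ≤ K) → IsGammaMaxForest d K
  gamma-max {K} K≤ upper with realised
  ... | F , forest , degs , lower =
    (F , forest , degs , exact (upper F forest degs) , (λ D dom → ≤-trans K≤ (lower D dom))) ,
    (λ F′ g forest′ degs′ (_ , minimal) → bound {F′} (upper F′ forest′ degs′) minimal)
    where
    exact : (∃ λ D → Dominating F D × ∣ D ∣ ≤ K) → ∃ λ D → Dominating F D × ∣ D ∣ ≡ K
    exact (D , dom , ≤K) = D , dom , ≤-antisym ≤K (≤-trans K≤ (lower D dom))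
    bound : ∀ {F : Graph n} {g} → (∃ λ D → Dominating F D × ∣ D ∣ ≤ K) → (∀ D → Dominating F D → g ≤ ∣ D ∣) → g ≤ K
    bound (D , dom , ≤K) minimal = ≤-trans (minimal D dom) ≤K

  more-leaves : m < ℓ → x ≡ 0
  more-leaves m<ℓ with x∨k
  ... | inj₁ x≡0 = x≡0
  ... | inj₂ k≡0 = contradiction m<ℓ (≤⇒≯ (begin
    ℓ     ≡⟨ trans ℓ≡q+k (trans (cong (q +_) k≡0) (+-identityʳ q)) ⟩
    q     ≤⟨ m≤m+n q x ⟩
    q + x ≡⟨ ≡.sym m≡q+x ⟩
    m     ∎))
    where open ≤-Reasoning

  more-internal : ℓ ≤ m → k ≡ 0
  more-internal ℓ≤m with x∨k
  ... | inj₂ k≡0  = k≡0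
  ... | inj₁ x≡0  = n≤0⇒n≡0 (+-cancelˡ-≤ q _ _ (≤-trans (≤-reflexive (≡.sym ℓ≡q+k))
                      (≤-trans ℓ≤m (≤-reflexive (trans m≡q+x (cong (q +_) x≡0))))))

  m≡q : m < ℓ → m ≡ q
  m≡q m<ℓ = trans m≡q+x (trans (cong (q +_) (more-leaves m<ℓ)) (+-identityʳ q))

  ℓ∸m≡k : m < ℓ → ℓ ∸ m ≡ k
  ℓ∸m≡k m<ℓ = trans (cong₂ _∸_ ℓ≡q+k (m≡q m<ℓ)) (m+n∸m≡n q k)

  k≤2r+1 : p ≤ 1 → k ≤ 2 * r + 1
  k≤2r+1 p≤1 = ≤-trans (≤-reflexive (≡.sym p+2r≡k)) (≤-trans (+-monoˡ-≤ (2 * r) p≤1) (≤-reflexive (+-comm 1 (2 * r))))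

  -- The `m` pairs and `r` components K₂ are blocks, so `c ≤ r` suffices.
  case-1 : m < ℓ → c < ⌈ ℓ ∸ m /2⌉ → IsGammaMaxForest d (n ∸ ℓ + suc c ∸ 1)
  case-1 m<ℓ c< rewrite ℓ∸m≡k m<ℓ = subst (IsGammaMaxForest d) (≡.sym K≡) (gamma-max K≤ upper)
    where
    K≡ : n ∸ ℓ + suc c ∸ 1 ≡ m + c
    K≡ = cong (_∸ 1) (trans (cong (_+ suc c) (trans (cong (_∸ ℓ) (≡.sym m+ℓ≡n)) (m+n∸n≡m m ℓ))) (+-suc m c))
    c≤r : c ≤ r
    c≤r with r∨p
    ... | inj₁ r≡c = ≤-reflexive (≡.sym r≡c)
    -- By definition `⌈ k /2⌉` is `⌊ suc k /2⌋`, and `k ≤ 2 * r + 1` makes it at most `suc r`.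
    ... | inj₂ p≤1 = s≤s⁻¹ (≤-trans c< (⌊/2⌋-≤ (≤-trans (s≤s (k≤2r+1 p≤1)) (≤-trans (n≤1+n _) (≤-reflexive (shuffle r))))))
      where
      shuffle : ∀ r → suc (suc (2 * r + 1)) ≡ 2 * suc r + 1
      shuffle = solve-∀
    K≤ : m + c ≤ r + q + t
    K≤ = ≤-trans (+-mono-≤ (≤-reflexive (m≡q m<ℓ)) c≤r) (≤-trans (≤-reflexive (+-comm q r)) (m≤m+n (r + q) t))
    upper : ∀ F → IsForest F → HasDegSeq F d → ∃ λ D → Dominating F D × ∣ D ∣ ≤ m + c
    upper F forest degs with UpperBounds.internal-bound F forest d 1≤d degs (suc c) i₀ 2≤di₀ sum-eq
    ... | D , dom , le = D , dom , s≤s⁻¹ (*-cancelˡ-≤ 2 (≤-trans (≤-reflexive (trans (*-suc 2 _) (+-comm 2 _)))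
                           (≤-trans le (≤-reflexive (cong (2 *_) (+-suc m c))))))

  -- The pairs and the K₂ components cover all vertices but at most one, because `k ≤ 2 * r + 1` in
  -- both alternatives for `r` and `p`.
  case-2 : m < ℓ → ⌈ ℓ ∸ m /2⌉ ≤ c → IsGammaMaxForest d ⌊ n /2⌋
  case-2 m<ℓ ≤c rewrite ℓ∸m≡k m<ℓ = gamma-max (⌊/2⌋-≤ n≤) upper
    where
    open ≤-Reasoning
    k≤ : k ≤ 2 * r + 1
    k≤ with r∨p
    ... | inj₁ r≡c = ≤-trans (≤-⌈/2⌉ ≤c) (≤-trans (≤-reflexive (cong (2 *_) (≡.sym r≡c))) (m≤m+n _ 1))
    ... | inj₂ p≤1 = k≤2r+1 p≤1
    shuffle : ∀ q r → q + (q + (2 * r + 1)) ≡ 2 * (r + q) + 1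
    shuffle = solve-∀
    n≤ : n ≤ 2 * (r + q + t) + 1
    n≤ = begin
      n                         ≡⟨ ≡.sym m+ℓ≡n ⟩
      m + ℓ                     ≡⟨ cong₂ _+_ (m≡q m<ℓ) ℓ≡q+k ⟩
      q + (q + k)               ≤⟨ +-monoʳ-≤ q (+-monoʳ-≤ q k≤) ⟩
      q + (q + (2 * r + 1))     ≡⟨ shuffle q r ⟩
      2 * (r + q) + 1           ≤⟨ +-monoˡ-≤ 1 (*-monoʳ-≤ 2 (m≤m+n (r + q) t)) ⟩
      2 * (r + q + t) + 1       ∎
    upper : ∀ F → IsForest F → HasDegSeq F d → ∃ λ D → Dominating F D × ∣ D ∣ ≤ ⌊ n /2⌋
    upper F forest degs with UpperBounds.half-bound F forest d 1≤d degs
    ... | D , dom , le = D , dom , ≤-⌊/2⌋ le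

  -- As `n + ℓ` is at least 2, the rounded-up quotient is `(n + ℓ) / 3`. Now `n + ℓ` equals
  -- `3 q + x`, and the chain leaves at most two vertices outside its triples, which the rounding
  -- absorbs.
  case-3 : ℓ ≤ m → IsGammaMaxForest d ⌈ n + ℓ ∸ 2 / 3 ⌉
  case-3 ℓ≤m = subst (IsGammaMaxForest d) (≡.sym (cong (_/ 3) (m∸n+n≡m 2≤n+ℓ))) (gamma-max K≤ upper)
    where
    open ≤-Reasoning
    ℓ≡q : ℓ ≡ q
    ℓ≡q = trans ℓ≡q+k (trans (cong (q +_) (more-internal ℓ≤m)) (+-identityʳ q))
    n+ℓ≡ : n + ℓ ≡ 3 * q + x
    n+ℓ≡ = trans (cong₂ _+_ (≡.sym m+ℓ≡n) ℓ≡q) (trans (cong₂ (λ a b → a + b + q) m≡q+x ℓ≡q) (shuffle q x))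
      where
      shuffle : ∀ q x → q + x + q + q ≡ 3 * q + x
      shuffle = solve-∀
    2≤n+ℓ : 2 ≤ n + ℓ
    2≤n+ℓ = ≤-trans (*-cancelˡ-≤ 2 (begin
      2 + 2                      ≤⟨ +-mono-≤ (≤-trans 2≤di₀ (f≤∑ d (∈-allFin i₀))) (*-monoʳ-≤ 2 (s≤s z≤n)) ⟩
      seqSum d + 2 * suc c       ≡⟨ sum-eq ⟩
      2 * n                      ∎)) (m≤m+n n ℓ)
    shuffle : ∀ r q t → suc (3 * q + (3 * t + 2)) + r * 3 ≡ suc (r + q + t) * 3
    shuffle = solve-∀
    K≤ : (n + ℓ) / 3 ≤ r + q + t
    K≤ = s≤s⁻¹ (m<n*o⇒m/o<n {n + ℓ} {suc (r + q + t)} {3} (begin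
      suc (n + ℓ)                          ≡⟨ cong suc n+ℓ≡ ⟩
      suc (3 * q + x)                      ≤⟨ s≤s (+-monoʳ-≤ (3 * q) x≤3t+2) ⟩
      suc (3 * q + (3 * t + 2))            ≤⟨ m≤m+n _ (r * 3) ⟩
      suc (3 * q + (3 * t + 2)) + r * 3    ≡⟨ shuffle r q t ⟩
      suc (r + q + t) * 3                  ∎))
    upper : ∀ F → IsForest F → HasDegSeq F d → ∃ λ D → Dominating F D × ∣ D ∣ ≤ (n + ℓ) / 3
    upper F forest degs with UpperBounds.third-bound F forest d 1≤d degs
    ... | D , dom , le = D , dom , ≤-trans (≤-reflexive (≡.sym (m*n/n≡m ∣ D ∣ 3)))
                           (/-monoˡ-≤ 3 (≤-trans (≤-reflexive (*-comm ∣ D ∣ 3)) le))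

theorem1 : (n : ℕ) (d : Fin n → ℕ) (c : ℕ) →
    (∀ i → 1 ≤ d i) →
    (∀ i j → i ≤ᶠ j → d j ≤ d i) →
    (Σ (Fin n) λ i → 2 ≤ d i) →
    1 ≤ c →
    seqSum d + 2 * c ≡ 2 * n →
    ((count≥ 2 d < count= 1 d) → (c ∸ 1) < ⌈ count= 1 d ∸ count≥ 2 d /2⌉ →
    IsGammaMaxForest d (n ∸ count= 1 d + c ∸ 1))
    × ((count≥ 2 d < count= 1 d) → ⌈ count= 1 d ∸ count≥ 2 d /2⌉ ≤ c ∸ 1 →
    IsGammaMaxForest d ⌊ n /2⌋)
    × (count= 1 d ≤ count≥ 2 d →
    IsGammaMaxForest d ⌈ n + count= 1 d ∸ 2 / 3 ⌉)
theorem1 n d (suc c) 1≤d noninc (i₀ , 2≤di₀) 1≤c sum-eq = case-1 , case-2 , case-3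
  where open DegreeSequence d c 1≤d noninc i₀ 2≤di₀ sum-eq
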